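{- Let $a\ge 0$, $b\ge 1$, $c\ge 1$ be integers and put $n=a+b+c$. Let $G$ be the graph obtained as follows: take the complete graph $K_{b+1}$ and two distinct vertices $w,v$ of it; glue a complete graph $K_c$ to $K_{b+1}$ by identifying one vertex of $K_c$ with $w$ (so the two cliques share exactly the vertex $w$); and attach at $v$ a path of length $a$ ($a$ new vertices forming a path with end $v$). Then \[ \frac{X_{G}}{(b-1)!\,(c-1)!}=\sum_{\substack{K\vDash n\\ k_{ -1}\ge b+c}} b\, w_K\, e_K+\sum_{\substack{K\vDash n,\ \ell(K)\ge 2,\ k_{ -1}+k_{ -2}\ge b+c\\ k_{ -1}\le \min(b-1,c-1)\ \text{or}\ k_{ -1}\ge \max(b+1,c)}} |b-k_{ -1}|\, w_{K\backslash k_{ -1}}\, e_K, \] which is a positive $e_I$-expansion.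
   Context: For a finite simple graph $G$, $X_G=\sum_{\kappa}\prod_{v\in V(G)}x_{\kappa(v)}$ over proper colorings $\kappa:V(G)\to\{1,2,\dots\}$; $e_k$ is the $k$-th elementary symmetric function. A composition $K=k_1\dotsm k_l\vDash n$ is a sequence of positive integers summing to $n$, with length $\ell(K)=l$; $k_{ -1}=k_l$ and $k_{ -2}=k_{l-1}$ are its last and second-last parts, and $K\backslash k_{ -1}=k_1\dotsm k_{l-1}$. $e_K=e_{k_1}\dotsm e_{k_l}$ and $w_K=k_1(k_2-1)(k_3-1)\dotsm(k_l-1)$. An $e_I$-expansion $\sum_K d_Ke_K$ is interpreted in the basis $e_\lambda$ by collecting compositions with the same multiset of parts; it is positive if all $d_K\ge 0$.
   Formalization: The second sum carries the added condition k_{ -1} < b+c, without which the formula fails for every a ≥ 1 (e.g. a=b=1, c=2); the identity is stated as equality of values at all integer points in N variables for every N, with the factorials multiplied to the right. -}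

module Defs where

open import Data.Bool using (Bool; true; false; _∧_; _∨_; not; if_then_else_)
open import Data.Nat using (_!; ℕ; zero; suc; _+_; _*_; _∸_; _≤ᵇ_; _<ᵇ_; _≡ᵇ_; ∣_-_∣; _⊔_; _⊓_)
import Data.Nat as ℕ
open import Data.Integer using (ℤ; +_) renaming (_+_ to _+ℤ_; _*_ to _*ℤ_)
open import Data.Fin using (Fin; toℕ)
import Data.Fin as Fin
open import Data.List using (List; []; _∷_; map; concatMap; filter; upTo; allFin; foldr; reverse; length)
open import Data.Vec using (Vec; []; _∷_; lookup; toList)
open import Relation.Nullary.Decidable using (⌊_⌋)
open import Data.Bool.ListAction using (all)
open import Data.Nat.ListAction using (sum)

sumℤ : List ℤ → ℤ
sumℤ = foldr _+ℤ_ (+ 0)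

prodℤ : List ℤ → ℤ
prodℤ = foldr _*ℤ_ (+ 1)

allVecs : {A : Set} → List A → (m : ℕ) → List (Vec A m)
allVecs xs zero    = [] ∷ []
allVecs xs (suc m) = concatMap (λ y → map (y ∷_) (allVecs xs m)) xs

Graph : ℕ → Set
Graph m = Fin m → Fin m → Bool

proper : {m N : ℕ} → Graph m → Vec (Fin N) m → Bool
proper {m} G κ =
  all (λ u → all (λ v →
      not (G u v) ∨ not ⌊ lookup κ u Fin.≟ lookup κ v ⌋) (allFin m)) (allFin m)

-- Chromatic symmetric function X_G restricted to N variables x_0..x_{N-1}
-- and evaluated at x : Fin N → ℤ:
--   X_G(x) = Σ_{κ proper colouring V(G) → [N]} Π_v x_{κ(v)}
chromX : {m : ℕ} → Graph m → (N : ℕ) → (Fin N → ℤ) → ℤ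
chromX {m} G N x =
  sumℤ (map (λ κ → if proper G κ
                    then prodℤ (map (λ v → x (lookup κ v)) (allFin m))
                    else + 0)
            (allVecs (allFin N) m))

-- Elementary symmetric functions in N variables, evaluated at x.
-- Subsets of [N] as characteristic vectors S : Vec Bool N.

card : {N : ℕ} → Vec Bool N → ℕ
card S = foldr (λ b k → if b then suc k else k) 0 (toList S)

elem : ℕ → (N : ℕ) → (Fin N → ℤ) → ℤ
elem k N x =
  sumℤ (map (λ S → if card S ≡ᵇ k
                    then prodℤ (map (λ i → if lookup S i then x i else + 1) (allFin N))
                    else + 0)
            (allVecs (true ∷ false ∷ []) N))

elemK : List ℕ → (N : ℕ) → (Fin N → ℤ) → ℤ
elemK K N x = prodℤ (map (λ k → elem k N x) K)

compositions : ℕ → List (List ℕ)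
compositions n =
  filter (λ K → sum K ℕ.≟ n)
    (concatMap (λ l → map toList (allVecs (map suc (upTo n)) l)) (upTo (suc n)))

-- w_K = k_1 (k_2 - 1) ⋯ (k_l - 1)   (w_[] := 1, never used)
wK : List ℕ → ℕ
wK []      = 1
wK (k ∷ K) = k * foldr (λ j r → (j ∸ 1) * r) 1 K

-- last part k_{-1} (0 for the empty list, never used)
lastPart : List ℕ → ℕ
lastPart K with reverse K
... | []    = 0
... | k ∷ _ = k

-- The graph G(a,b,c) on vertex set {0,…,a+b+c-1}:
--   clique K_{b+1} on {0,…,b}, with w = 0 and v = b;
--   clique K_c on {0} ∪ {b+1,…,b+c-1} (shares exactly w = 0 with K_{b+1});
--   path v = b, b+c, b+c+1, …, b+c+a-1 (a new vertices, end v).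

edgeℕ : ℕ → ℕ → ℕ → ℕ → Bool
edgeℕ b c i j =
  (i <ᵇ j) ∧
  ( (j ≤ᵇ b)                                                    -- K_{b+1}
  ∨ (((i ≡ᵇ 0) ∨ (suc b ≤ᵇ i)) ∧ (suc b ≤ᵇ j) ∧ (j ≤ᵇ b + c ∸ 1)) -- K_c
  ∨ ((i ≡ᵇ b) ∧ (j ≡ᵇ b + c))                                    -- v – first path vertex
  ∨ ((b + c ≤ᵇ i) ∧ (j ≡ᵇ suc i)) )                              -- path edges

G5p4 : (a b c : ℕ) → Graph (a + b + c)
G5p4 a b c u v = edgeℕ b c (toℕ u) (toℕ v) ∨ edgeℕ b c (toℕ v) (toℕ u)

coeff₁ : (b c : ℕ) → List ℕ → ℕ
coeff₁ b c K = if b + c ≤ᵇ lastPart K then b * wK K else 0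

coeff₂ : (b c : ℕ) → List ℕ → ℕ
coeff₂ b c K with reverse K
... | k₁ ∷ k₂ ∷ rest =
      if (k₁ <ᵇ b + c) ∧ (b + c ≤ᵇ k₁ + k₂) ∧ ((k₁ ≤ᵇ (b ∸ 1) ⊓ (c ∸ 1)) ∨ ((suc b ⊔ c) ≤ᵇ k₁))
      then ∣ b - k₁ ∣ * wK (reverse (k₂ ∷ rest))
      else 0
... | _ = 0

{-# OPTIONS --safe #-}
module Submission where

open import Defs
open import Data.Bool using (Bool; true; false; T; _∧_; _∨_; not; if_then_else_)
open import Data.Bool.ListAction using (all)
open import Data.Bool.Properties using (T-∧; T-∨; T-≡; ⇔→≡)
open import Data.Fin using (Fin; zero; suc; toℕ)
import Data.Fin as Fin
open import Data.Integer using (ℤ; +_) renaming (_+_ to _+ℤ_; _*_ to _*ℤ_; _-_ to _-ℤ_; -_ to -ℤ_)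
import Data.Integer.Properties as ℤ
open import Data.Integer.Tactic.RingSolver using (solve-∀)
open import Data.List
  using (List; []; _∷_; [_]; _∷ʳ_; _∷ʳ′_; initLast; map; concatMap; filter; foldr; reverse; upTo; allFin)
  renaming (_++_ to _++ˡ_)
open import Data.List.Properties using (map-∘; map-tabulate; map-applyUpTo; reverse-++; reverse-involutive)
import Data.List.Relation.Unary.All.Properties as All
open import Data.Nat
  using (_!; ℕ; zero; suc; _+_; _*_; _∸_; _≤_; _<_; _≡ᵇ_; _≤ᵇ_; _<ᵇ_; _⊓_; _⊔_; ∣_-_∣; z≤n; s≤s)
import Data.Nat.Properties as ℕ
open import Data.Nat.Induction using (<-rec)
open import Data.Nat.ListAction using (sum)
open import Data.Nat.ListAction.Properties using (sum-++)
open import Data.Product using (_×_; _,_; ∃; proj₁; proj₂)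
open import Data.Sum using (_⊎_; inj₁; inj₂; [_,_]′)
open import Data.Unit using (tt)
open import Data.Vec using (Vec; []; _∷_; _++_; lookup; toList) renaming (_∷ʳ_ to _∷ʳᵛ_)
open import Data.Vec.Properties using (toList-∷ʳ)
open import Function using (_∘_; id; mk⇔; Equivalence)
open import Relation.Binary.PropositionalEquality
  using (_≡_; _≗_; _≢_; refl; sym; trans; cong; cong₂; subst; module ≡-Reasoning)
open import Relation.Nullary using (does; yes; no; ¬_; contradiction)
open import Relation.Nullary.Decidable using (⌊_⌋)
open import Relation.Unary using (Decidable)

-- Write x ∖ i for the variables other than x i. Conditioning on the colours i of w and j of v, the
-- chromatic function divided by (b - 1)! (c - 1)! is
--   Σ_j x_j P_a(j) Σ_{i ≠ j} x_i e_{b-1}(x ∖ j ∖ i) e_{c-1}(x ∖ i),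
-- where P_a(j) is the generating function of the colourings of the path. Expanding by
-- e_{p+1}(y) = e_{p+1}(y ∖ i) + y_i e_p(y ∖ i), the inner sum turns into a sum of products
-- e_k(x) e_l(x ∖ j) with k + l = b + c - 1 and coefficient |b - k|, where k is at most
-- min(b, c) - 1 or at least max(b, c). Then Σ_j x_j e_l(x ∖ j) P_a(j) is the chromatic function of
-- a lollipop up to a factorial, hence the sum of w_K e_K over the compositions K of l + 1 + a with
-- last part greater than l: both satisfy the same recurrence. So e_k(x) contributes the
-- compositions with last part k, and k = 0 gives the first sum of the theorem.

open ≡-Reasoning
open Equivalence using (to; from)

-- The colour `j` of v couples everything: it is barred from the rest of the first clique and from
-- the first path vertex, but not from the second clique. The sum over `j` becomes a lollipop only
-- if, besides the path, a single factor depends on `j`; hence the products of one `e k x` with one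
-- `e l (x ∖ j)`. The weights b - k and l - b on such a pair serve two purposes. In the part free of
-- x_j they add up to l - k, the coefficient met when vertices are moved one by one between two
-- cliques sharing a vertex. In the part with x_j, neighbouring pairs produce the same product and b
-- cancels, except in one boundary term with factor max(b, c) - b. It vanishes when b ≥ c, and when
-- b ≤ c it is the cost of one more such move, so both orders of b and c lead to one formula in min
-- and max. As k stays below b and l is at least b, both weights are absolute values. Evaluation at
-- integer points for every number of variables determines the symmetric functions, and compositions
-- with the same parts merge by themselves.

private
  variable
    X Y : Set
    N m k l : ℕ

-- Finite sums

⟦_⟧ : Bool → ℤ
⟦ b ⟧ = if b then + 1 else + 0

⟦∧⟧ : ∀ p q → ⟦ p ∧ q ⟧ ≡ ⟦ p ⟧ *ℤ ⟦ q ⟧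
⟦∧⟧ true  q = sym (ℤ.*-identityˡ _)
⟦∧⟧ false q = refl

if≡⟦⟧* : ∀ p t → (if p then t else + 0) ≡ ⟦ p ⟧ *ℤ t
if≡⟦⟧* true  t = sym (ℤ.*-identityˡ t)
if≡⟦⟧* false t = refl

opaque
  ∑ : List X → (X → ℤ) → ℤ
  ∑ xs f = sumℤ (map f xs)

  ∑-def : ∀ (xs : List X) f → sumℤ (map f xs) ≡ ∑ xs f
  ∑-def xs f = refl

  ∑-[] : ∀ (f : X → ℤ) → ∑ [] f ≡ + 0
  ∑-[] f = refl

  ∑-∷ : ∀ x (xs : List X) f → ∑ (x ∷ xs) f ≡ f x +ℤ ∑ xs f
  ∑-∷ x xs f = refl

  ∑-cong : ∀ (xs : List X) {f g} → f ≗ g → ∑ xs f ≡ ∑ xs g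
  ∑-cong []       f≗g = refl
  ∑-cong (x ∷ xs) f≗g = cong₂ _+ℤ_ (f≗g x) (∑-cong xs f≗g)

  ∑-++ : ∀ (xs ys : List X) f → ∑ (xs ++ˡ ys) f ≡ ∑ xs f +ℤ ∑ ys f
  ∑-++ []       ys f = sym (ℤ.+-identityˡ _)
  ∑-++ (x ∷ xs) ys f = trans (cong (f x +ℤ_) (∑-++ xs ys f)) (sym (ℤ.+-assoc (f x) _ _))

  ∑-map : ∀ (h : X → Y) xs f → ∑ (map h xs) f ≡ ∑ xs (f ∘ h)
  ∑-map h xs f = cong sumℤ (sym (map-∘ xs))

  ∑-concatMap : ∀ (h : X → List Y) xs f → ∑ (concatMap h xs) f ≡ ∑ xs (λ x → ∑ (h x) f)
  ∑-concatMap h []       f = refl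
  ∑-concatMap h (x ∷ xs) f =
    trans (∑-++ (h x) (concatMap h xs) f) (cong (∑ (h x) f +ℤ_) (∑-concatMap h xs f))

  ∑-filter : ∀ {P : X → Set} (P? : Decidable P) xs f →
    ∑ (filter P? xs) f ≡ ∑ xs (λ x → ⟦ does (P? x) ⟧ *ℤ f x)
  ∑-filter P? []       f = refl
  ∑-filter P? (x ∷ xs) f with does (P? x)
  ... | true  = cong₂ _+ℤ_ (sym (ℤ.*-identityˡ (f x))) (∑-filter P? xs f)
  ... | false = trans (∑-filter P? xs f) (sym (ℤ.+-identityˡ _))

  ∑-0 : ∀ (xs : List X) → ∑ xs (λ _ → + 0) ≡ + 0
  ∑-0 []       = refl
  ∑-0 (x ∷ xs) = trans (ℤ.+-identityˡ _) (∑-0 xs)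

  ∑-+ : ∀ (xs : List X) f g → ∑ xs (λ x → f x +ℤ g x) ≡ ∑ xs f +ℤ ∑ xs g
  ∑-+ []       f g = refl
  ∑-+ (x ∷ xs) f g =
    trans (cong (f x +ℤ g x +ℤ_) (∑-+ xs f g)) (shuffle (f x) (g x) (∑ xs f) (∑ xs g))
    where
    shuffle : ∀ a b c d → a +ℤ b +ℤ (c +ℤ d) ≡ (a +ℤ c) +ℤ (b +ℤ d)
    shuffle = solve-∀

  ∑-*ˡ : ∀ (xs : List X) c f → ∑ xs (λ x → c *ℤ f x) ≡ c *ℤ ∑ xs f
  ∑-*ˡ []       c f = sym (ℤ.*-zeroʳ c)
  ∑-*ˡ (x ∷ xs) c f =
    trans (cong (c *ℤ f x +ℤ_) (∑-*ˡ xs c f)) (sym (ℤ.*-distribˡ-+ c (f x) _))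

  ∑-*ʳ : ∀ (xs : List X) c f → ∑ xs (λ x → f x *ℤ c) ≡ ∑ xs f *ℤ c
  ∑-*ʳ xs c f = begin
    ∑ xs (λ x → f x *ℤ c)  ≡⟨ ∑-cong xs (λ x → ℤ.*-comm (f x) c) ⟩
    ∑ xs (λ x → c *ℤ f x)  ≡⟨ ∑-*ˡ xs c f ⟩
    c *ℤ ∑ xs f            ≡⟨ ℤ.*-comm c _ ⟩
    ∑ xs f *ℤ c            ∎

  ∑-swap : ∀ (xs : List X) (ys : List Y) (f : X → Y → ℤ) →
    ∑ xs (λ x → ∑ ys (λ y → f x y)) ≡ ∑ ys (λ y → ∑ xs (λ x → f x y))
  ∑-swap []       ys f = sym (∑-0 ys)
  ∑-swap (x ∷ xs) ys f =
    trans (cong (∑ ys (f x) +ℤ_) (∑-swap xs ys f)) (sym (∑-+ ys (f x) (λ y → ∑ xs (λ x → f x y))))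

  ∑-allFin-suc : ∀ N f → ∑ (allFin (suc N)) f ≡ f zero +ℤ ∑ (allFin N) (f ∘ suc)
  ∑-allFin-suc N f = cong (λ l → f zero +ℤ sumℤ l)
    (trans (map-tabulate suc f) (sym (map-tabulate id (f ∘ suc))))

∑-allVecs-suc : ∀ (xs : List X) m f →
  ∑ (allVecs xs (suc m)) f ≡ ∑ xs (λ y → ∑ (allVecs xs m) (λ v → f (y ∷ v)))
∑-allVecs-suc xs m f = trans (∑-concatMap _ xs f)
  (∑-cong xs (λ y → ∑-map (y ∷_) (allVecs xs m) f))

prod-allFin-suc : ∀ N (f : Fin (suc N) → ℤ) →
  prodℤ (map f (allFin (suc N))) ≡ f zero *ℤ prodℤ (map (f ∘ suc) (allFin N))
prod-allFin-suc N f = cong (λ l → f zero *ℤ prodℤ l)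
  (trans (map-tabulate suc f) (sym (map-tabulate id (f ∘ suc))))

monomial : (Fin N → ℤ) → Vec Bool N → ℤ
monomial x S = prodℤ (map (λ i → if lookup S i then x i else + 1) (allFin _))

monomial-∷ : ∀ (x : Fin (suc N) → ℤ) b S →
  monomial x (b ∷ S) ≡ (if b then x zero else + 1) *ℤ monomial (x ∘ suc) S
monomial-∷ x b S = prod-allFin-suc _ (λ i → if lookup (b ∷ S) i then x i else + 1)

-- Elementary symmetric functions

-- Splits on whether the first variable is used; unlike the subset sum `elem`, this form supports
-- induction on the variables.
e : ℕ → (Fin N → ℤ) → ℤ
e             zero    x = + 1
e {N = zero}  (suc k) x = + 0
e {N = suc N} (suc k) x = x zero *ℤ e k (x ∘ suc) +ℤ e (suc k) (x ∘ suc)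

subsets : ∀ N → List (Vec Bool N)
subsets = allVecs (true ∷ false ∷ [])

elem-∑ : ∀ k N x → elem k N x ≡ ∑ (subsets N) (λ S → if card S ≡ᵇ k then monomial x S else + 0)
elem-∑ k N x = ∑-def (subsets N) _

∑-subsets-suc : ∀ N f →
  ∑ (subsets (suc N)) f ≡ ∑ (subsets N) (f ∘ (true ∷_)) +ℤ ∑ (subsets N) (f ∘ (false ∷_))
∑-subsets-suc N f = trans (∑-allVecs-suc (true ∷ false ∷ []) N f)
  (trans (∑-∷ _ _ _) (cong (∑ (subsets N) (f ∘ (true ∷_)) +ℤ_)
    (trans (∑-∷ _ _ _) (trans (cong (∑ (subsets N) (f ∘ (false ∷_)) +ℤ_) (∑-[] _)) (ℤ.+-identityʳ _)))))

∑-subsets-false : ∀ k N (x : Fin (suc N) → ℤ) →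
  ∑ (subsets N) (λ S → if card S ≡ᵇ k then monomial x (false ∷ S) else + 0) ≡ elem k N (x ∘ suc)
∑-subsets-false k N x = trans
  (∑-cong (subsets N) (λ S → cong (λ t → if card S ≡ᵇ k then t else + 0)
    (trans (monomial-∷ x false S) (ℤ.*-identityˡ _))))
  (sym (elem-∑ k N (x ∘ suc)))

elem≡e : ∀ k N (x : Fin N → ℤ) → elem k N x ≡ e k x
elem≡e zero    zero    x = refl
elem≡e (suc k) zero    x = refl
elem≡e zero    (suc N) x = begin
  elem 0 (suc N) x
    ≡⟨ trans (elem-∑ 0 (suc N) x) (∑-subsets-suc N _) ⟩
  ∑ (subsets N) (λ _ → + 0)
    +ℤ ∑ (subsets N) (λ S → if card S ≡ᵇ 0 then monomial x (false ∷ S) else + 0)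
    ≡⟨ cong₂ _+ℤ_ (∑-0 (subsets N)) (∑-subsets-false 0 N x) ⟩
  + 0 +ℤ elem 0 N (x ∘ suc)
    ≡⟨ ℤ.+-identityˡ _ ⟩
  elem 0 N (x ∘ suc)
    ≡⟨ elem≡e 0 N (x ∘ suc) ⟩
  + 1 ∎
elem≡e (suc k) (suc N) x = begin
  elem (suc k) (suc N) x
    ≡⟨ trans (elem-∑ (suc k) (suc N) x) (∑-subsets-suc N _) ⟩
  ∑ (subsets N) (λ S → if card S ≡ᵇ k then monomial x (true ∷ S) else + 0)
    +ℤ ∑ (subsets N) (λ S → if card S ≡ᵇ suc k then monomial x (false ∷ S) else + 0)
    ≡⟨ cong₂ _+ℤ_
         (trans (∑-cong (subsets N) λ S →
                   trans (cong (λ t → if card S ≡ᵇ k then t else + 0) (monomial-∷ x true S))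
                         (pull (card S ≡ᵇ k) _))
         (trans (∑-*ˡ (subsets N) (x zero) (λ S → if card S ≡ᵇ k then monomial (x ∘ suc) S else + 0))
                (cong (x zero *ℤ_) (sym (elem-∑ k N (x ∘ suc))))))
         (∑-subsets-false (suc k) N x) ⟩
  x zero *ℤ elem k N (x ∘ suc) +ℤ elem (suc k) N (x ∘ suc)
    ≡⟨ cong₂ (λ s t → x zero *ℤ s +ℤ t) (elem≡e k N (x ∘ suc)) (elem≡e (suc k) N (x ∘ suc)) ⟩
  e (suc k) x ∎
  where
  pull : ∀ p t → (if p then x zero *ℤ t else + 0) ≡ x zero *ℤ (if p then t else + 0)
  pull true  t = refl
  pull false t = sym (ℤ.*-zeroʳ (x zero))

e-cong : ∀ k {x y : Fin N → ℤ} → x ≗ y → e k x ≡ e k y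
e-cong             zero    x≗y = refl
e-cong {N = zero}  (suc k) x≗y = refl
e-cong {N = suc N} (suc k) x≗y =
  cong₂ _+ℤ_ (cong₂ _*ℤ_ (x≗y zero) (e-cong k (x≗y ∘ suc))) (e-cong (suc k) (x≗y ∘ suc))

-- Setting x i to 0 has the same effect on elementary symmetric functions as removing it.
infixl 8 _∖_
_∖_ : (Fin N → ℤ) → Fin N → Fin N → ℤ
(x ∖ i) j = if does (i Fin.≟ j) then + 0 else x j

∖-self : ∀ (x : Fin N → ℤ) i → (x ∖ i) i ≡ + 0
∖-self x zero    = refl
∖-self x (suc i) = ∖-self (x ∘ suc) i

∖-other : ∀ (x : Fin N → ℤ) {i j} → i ≢ j → (x ∖ i) j ≡ x j
∖-other x {i} {j} i≢j with i Fin.≟ j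
... | yes i≡j with () ← i≢j i≡j
... | no  _   = refl

∖-swap : ∀ (x : Fin N → ℤ) i j → x ∖ i ∖ j ≗ x ∖ j ∖ i
∖-swap x i j k with does (i Fin.≟ k) | does (j Fin.≟ k)
... | true  | true  = refl
... | true  | false = refl
... | false | true  = refl
... | false | false = refl

-- Monomials split by whether they contain `x i`. The induction runs to the position of `i`, where
-- the zeroed variable contributes nothing.
e-remove : ∀ k (x : Fin N → ℤ) i → e (suc k) x ≡ e (suc k) (x ∖ i) +ℤ x i *ℤ e k (x ∖ i)
e-remove zero    x zero    = lemma (x zero) (e 1 (x ∘ suc))
  where
  lemma : ∀ a r → a *ℤ + 1 +ℤ r ≡ + 0 *ℤ + 1 +ℤ r +ℤ a *ℤ + 1
  lemma = solve-∀
e-remove (suc k) x zero    =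
  lemma (x zero) (e (suc k) (x ∘ suc)) (e (suc (suc k)) (x ∘ suc)) (e k (x ∘ suc))
  where
  lemma : ∀ a r s t → a *ℤ r +ℤ s ≡ + 0 *ℤ r +ℤ s +ℤ a *ℤ (+ 0 *ℤ t +ℤ r)
  lemma = solve-∀
e-remove zero    x (suc i) = trans (cong (x zero *ℤ + 1 +ℤ_) (e-remove zero (x ∘ suc) i))
  (sym (ℤ.+-assoc (x zero *ℤ + 1) _ _))
e-remove (suc k) x (suc i) =
  trans (cong₂ (λ s t → x zero *ℤ s +ℤ t) (e-remove k (x ∘ suc) i) (e-remove (suc k) (x ∘ suc) i))
    (lemma (x zero) (x (suc i)) (e (suc k) (x ∘ suc ∖ i)) (e k (x ∘ suc ∖ i)) (e (suc (suc k)) (x ∘ suc ∖ i)))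
  where
  lemma : ∀ a b r s t →
    a *ℤ (r +ℤ b *ℤ s) +ℤ (t +ℤ b *ℤ r) ≡ a *ℤ r +ℤ t +ℤ b *ℤ (a *ℤ s +ℤ r)
  lemma = solve-∀

-- Each monomial of `e (suc k) x` arises once for each of its `suc k` variables.
∑-e-remove : ∀ k (x : Fin N → ℤ) →
  ∑ (allFin N) (λ i → x i *ℤ e k (x ∖ i)) ≡ + suc k *ℤ e (suc k) x
∑-e-remove {zero}  k       x = trans (∑-[] _) (sym (ℤ.*-zeroʳ (+ suc k)))
∑-e-remove {suc N} zero    x = begin
  ∑ (allFin (suc N)) (λ i → x i *ℤ + 1)          ≡⟨ ∑-allFin-suc N _ ⟩
  x zero *ℤ + 1 +ℤ ∑ (allFin N) (λ i → x (suc i) *ℤ + 1)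
    ≡⟨ cong (x zero *ℤ + 1 +ℤ_) (∑-e-remove zero (x ∘ suc)) ⟩
  x zero *ℤ + 1 +ℤ + 1 *ℤ e 1 (x ∘ suc)          ≡⟨ lemma (x zero) (e 1 (x ∘ suc)) ⟩
  + 1 *ℤ e 1 x                                   ∎
  where
  lemma : ∀ a r → a *ℤ + 1 +ℤ + 1 *ℤ r ≡ + 1 *ℤ (a *ℤ + 1 +ℤ r)
  lemma = solve-∀
∑-e-remove {suc N} (suc k) x = begin
  ∑ (allFin (suc N)) (λ i → x i *ℤ e (suc k) (x ∖ i))
    ≡⟨ ∑-allFin-suc N _ ⟩
  x₀ *ℤ (+ 0 *ℤ e k y +ℤ e (suc k) y)
    +ℤ ∑ (allFin N) (λ i → y i *ℤ (x₀ *ℤ e k (y ∖ i) +ℤ e (suc k) (y ∖ i)))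
    ≡⟨ cong (x₀ *ℤ (+ 0 *ℤ e k y +ℤ e (suc k) y) +ℤ_)
         (trans (∑-cong (allFin N) (λ i → expand (y i) x₀ (e k (y ∖ i)) (e (suc k) (y ∖ i))))
         (trans (∑-+ (allFin N) _ _)
           (cong₂ _+ℤ_ (trans (∑-*ˡ (allFin N) x₀ _) (cong (x₀ *ℤ_) (∑-e-remove k y)))
                       (∑-e-remove (suc k) y)))) ⟩
  x₀ *ℤ (+ 0 *ℤ e k y +ℤ e (suc k) y)
    +ℤ (x₀ *ℤ (+ suc k *ℤ e (suc k) y) +ℤ (+ 1 +ℤ + suc k) *ℤ e (suc (suc k)) y)
    ≡⟨ collect x₀ (e k y) (e (suc k) y) (e (suc (suc k)) y) (+ suc k) ⟩
  (+ 1 +ℤ + suc k) *ℤ e (suc (suc k)) x ∎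
  where
  x₀ = x zero
  y  = x ∘ suc
  expand : ∀ a b r s → a *ℤ (b *ℤ r +ℤ s) ≡ b *ℤ (a *ℤ r) +ℤ a *ℤ s
  expand = solve-∀
  collect : ∀ a q r s k →
    a *ℤ (+ 0 *ℤ q +ℤ r) +ℤ (a *ℤ (k *ℤ r) +ℤ (+ 1 +ℤ k) *ℤ s) ≡ (+ 1 +ℤ k) *ℤ (a *ℤ r +ℤ s)
  collect = solve-∀

-- Sums of products of elementary symmetric functions

-- The sum of f i j over i + j ≡ p + q + 1 with i ≤ p.
W : (ℕ → ℕ → ℤ) → ℕ → ℕ → ℤ
W f zero    q = f 0 (suc q)
W f (suc p) q = f (suc p) (suc q) +ℤ W f p (suc q)

W-cong : ∀ {f g} p q → (∀ i j → i ≤ p → suc q ≤ j → i + j ≡ suc (p + q) → f i j ≡ g i j) →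
  W f p q ≡ W g p q
W-cong zero    q eq = eq 0 (suc q) z≤n ℕ.≤-refl refl
W-cong (suc p) q eq = cong₂ _+ℤ_ (eq (suc p) (suc q) ℕ.≤-refl ℕ.≤-refl (cong suc (ℕ.+-suc p q)))
  (W-cong p (suc q) (λ i j i≤p q<j i+j → eq i j (ℕ.m≤n⇒m≤1+n i≤p) (ℕ.<⇒≤ q<j)
    (trans i+j (cong suc (ℕ.+-suc p q)))))

W-+ : ∀ f g p q → W (λ i j → f i j +ℤ g i j) p q ≡ W f p q +ℤ W g p q
W-+ f g zero    q = refl
W-+ f g (suc p) q = trans (cong (f (suc p) (suc q) +ℤ g (suc p) (suc q) +ℤ_) (W-+ f g p (suc q)))
  (lemma (f (suc p) (suc q)) (g (suc p) (suc q)) (W f p (suc q)) (W g p (suc q)))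
  where
  lemma : ∀ a b c d → a +ℤ b +ℤ (c +ℤ d) ≡ (a +ℤ c) +ℤ (b +ℤ d)
  lemma = solve-∀

W-*ˡ : ∀ c f p q → W (λ i j → c *ℤ f i j) p q ≡ c *ℤ W f p q
W-*ˡ c f zero    q = refl
W-*ˡ c f (suc p) q = trans (cong (c *ℤ f (suc p) (suc q) +ℤ_) (W-*ˡ c f p (suc q)))
  (sym (ℤ.*-distribˡ-+ c _ _))

∑-W : ∀ (xs : List X) (f : X → ℕ → ℕ → ℤ) p q →
  ∑ xs (λ x → W (f x) p q) ≡ W (λ i j → ∑ xs (λ x → f x i j)) p q
∑-W xs f zero    q = refl
∑-W xs f (suc p) q = trans (∑-+ xs _ _)
  (cong (∑ xs (λ x → f x (suc p) (suc q)) +ℤ_) (∑-W xs f p (suc q)))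

-- Up to the factor `p ! * q !`, the chromatic function of two cliques on `suc p` and `suc q`
-- vertices that share one vertex, coloured `i`.
S : (Fin N → ℤ) → ℕ → ℕ → ℤ
S y p q = ∑ (allFin _) (λ i → y i *ℤ (e p (y ∖ i) *ℤ e q (y ∖ i)))

S-comm : ∀ (y : Fin N → ℤ) p q → S y p q ≡ S y q p
S-comm y p q = ∑-cong (allFin _) (λ i → cong (y i *ℤ_) (ℤ.*-comm (e p (y ∖ i)) _))

S-zero : ∀ (y : Fin N → ℤ) q → S y 0 q ≡ + suc q *ℤ e (suc q) y
S-zero y q = trans (∑-cong (allFin _) (λ i → cong (y i *ℤ_) (ℤ.*-identityˡ (e q (y ∖ i)))))
  (∑-e-remove q y)

-- Expanding e (p + 1) in S y (p + 1) q and e (q + 1) in S y p (q + 1) by e-remove leaves the same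
-- remainder, with terms y i ^ 2.
S-step : ∀ (y : Fin N → ℤ) p q →
  S y (suc p) q ≡ (+ suc q -ℤ + suc p) *ℤ (e (suc p) y *ℤ e (suc q) y) +ℤ S y p (suc q)
S-step {N} y p q = begin
  S y (suc p) q
    ≡⟨ ∑-cong (allFin N) (λ i → cross (y i) (e p (y ∖ i)) (e q (y ∖ i)) (e (suc p) (y ∖ i)) (e (suc q) (y ∖ i))
                              (e-remove p y i) (e-remove q y i)) ⟩
  ∑ (allFin N) (λ i → e (suc p) y *ℤ (y i *ℤ e q (y ∖ i)) +ℤ
    ((-ℤ e (suc q) y) *ℤ (y i *ℤ e p (y ∖ i)) +ℤ y i *ℤ (e p (y ∖ i) *ℤ e (suc q) (y ∖ i))))
    ≡⟨ trans (∑-+ (allFin N) _ _) (cong₂ _+ℤ_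
         (trans (∑-*ˡ (allFin N) (e (suc p) y) _) (cong (e (suc p) y *ℤ_) (∑-e-remove q y)))
         (trans (∑-+ (allFin N) _ _) (cong (_+ℤ S y p (suc q))
           (trans (∑-*ˡ (allFin N) (-ℤ e (suc q) y) _) (cong ((-ℤ e (suc q) y) *ℤ_) (∑-e-remove p y)))))) ⟩
  e (suc p) y *ℤ (+ suc q *ℤ e (suc q) y) +ℤ
    ((-ℤ e (suc q) y) *ℤ (+ suc p *ℤ e (suc p) y) +ℤ S y p (suc q))
    ≡⟨ collect (e (suc p) y) (e (suc q) y) (+ suc p) (+ suc q) (S y p (suc q)) ⟩
  (+ suc q -ℤ + suc p) *ℤ (e (suc p) y *ℤ e (suc q) y) +ℤ S y p (suc q) ∎
  where
  cross : ∀ a r s ep' eq' {ep eq} → ep ≡ ep' +ℤ a *ℤ r → eq ≡ eq' +ℤ a *ℤ s →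
    a *ℤ (ep' *ℤ s) ≡ ep *ℤ (a *ℤ s) +ℤ ((-ℤ eq) *ℤ (a *ℤ r) +ℤ a *ℤ (r *ℤ eq'))
  cross a r s ep' eq' refl refl = lemma a r s ep' eq'
    where
    lemma : ∀ a r s ep' eq' → a *ℤ (ep' *ℤ s) ≡
      (ep' +ℤ a *ℤ r) *ℤ (a *ℤ s) +ℤ ((-ℤ (eq' +ℤ a *ℤ s)) *ℤ (a *ℤ r) +ℤ a *ℤ (r *ℤ eq'))
    lemma = solve-∀
  collect : ∀ u v p q s → u *ℤ (q *ℤ v) +ℤ ((-ℤ v) *ℤ (p *ℤ u) +ℤ s) ≡ (q -ℤ p) *ℤ (u *ℤ v) +ℤ s
  collect = solve-∀

-- Each `S-step` moves one unit from `p` to `q` and leaves one product behind; at `p = 0` the last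
-- product comes from `S-zero`.
S≡W : ∀ (y : Fin N → ℤ) p q → S y p q ≡ W (λ i j → (+ j -ℤ + i) *ℤ (e i y *ℤ e j y)) p q
S≡W y zero    q = trans (S-zero y q) (lemma (+ suc q) (e (suc q) y))
  where
  lemma : ∀ a r → a *ℤ r ≡ (a -ℤ + 0) *ℤ (+ 1 *ℤ r)
  lemma = solve-∀
S≡W y (suc p) q = trans (S-step y p q)
  (cong ((+ suc q -ℤ + suc p) *ℤ (e (suc p) y *ℤ e (suc q) y) +ℤ_) (S≡W y p (suc q)))

-- The index is lowered by one, with value 0 below index 0, so that `e-remove` extends to `k = 0`.
-- In the same way `S⁻` lowers the first index of `S`.
e⁻ : ℕ → (Fin N → ℤ) → ℤ
e⁻ zero    x = + 0
e⁻ (suc k) x = e k x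

e-remove⁻ : ∀ k (x : Fin N → ℤ) i → e k x ≡ e k (x ∖ i) +ℤ x i *ℤ e⁻ k (x ∖ i)
e-remove⁻ zero    x i = sym (trans (cong (+ 1 +ℤ_) (ℤ.*-zeroʳ (x i))) (ℤ.+-identityʳ _))
e-remove⁻ (suc k) x i = e-remove k x i

S⁻ : (Fin N → ℤ) → ℕ → ℕ → ℤ
S⁻ y zero    q = + 0
S⁻ y (suc p) q = S y p q

-- Telescoping: the product of `e⁻ i y` and `e j y` occurs in the pair `(i, j)` with coefficient b -
-- i and in the pair `(i - 1, j + 1)` with coefficient j + 1 - b. The sum j - (i - 1) is free of b
-- and is the coefficient in the expansion of `S⁻ y p q`. Only the second half of the first pair
-- `(p, suc q)` finds no partner.
W-shifted : ∀ (b : ℤ) (y : Fin N → ℤ) p q →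
  W (λ i j → (b -ℤ + i) *ℤ (e⁻ i y *ℤ e j y) +ℤ (+ j -ℤ b) *ℤ (e i y *ℤ e⁻ j y)) p q
    ≡ (+ suc q -ℤ b) *ℤ (e p y *ℤ e q y) +ℤ S⁻ y p q
W-shifted b y zero q = lemma b (+ suc q) (e (suc q) y) (e q y)
  where
  lemma : ∀ b c r s →
    (b -ℤ + 0) *ℤ (+ 0 *ℤ r) +ℤ (c -ℤ b) *ℤ (+ 1 *ℤ s) ≡ (c -ℤ b) *ℤ (+ 1 *ℤ s) +ℤ + 0
  lemma = solve-∀
W-shifted b y (suc p) q = trans
  (cong (((b -ℤ + suc p) *ℤ (e p y *ℤ e (suc q) y) +ℤ (+ suc q -ℤ b) *ℤ (e (suc p) y *ℤ e q y)) +ℤ_)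
    (W-shifted b y p (suc q)))
  (finish p)
  where
  finish : ∀ p →
    (b -ℤ + suc p) *ℤ (e p y *ℤ e (suc q) y) +ℤ (+ suc q -ℤ b) *ℤ (e (suc p) y *ℤ e q y)
      +ℤ ((+ suc (suc q) -ℤ b) *ℤ (e p y *ℤ e (suc q) y) +ℤ S⁻ y p (suc q))
    ≡ (+ suc q -ℤ b) *ℤ (e (suc p) y *ℤ e q y) +ℤ S y p q
  finish zero    = trans (lemma b (+ suc q) (e (suc q) y) (e 1 y *ℤ e q y))
                     (cong ((+ suc q -ℤ b) *ℤ (e 1 y *ℤ e q y) +ℤ_) (sym (S-zero y q)))
    where
    lemma : ∀ b q r t → (b -ℤ + 1) *ℤ (+ 1 *ℤ r) +ℤ (q -ℤ b) *ℤ t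
      +ℤ ((+ 1 +ℤ q -ℤ b) *ℤ (+ 1 *ℤ r) +ℤ + 0) ≡ (q -ℤ b) *ℤ t +ℤ q *ℤ r
    lemma = solve-∀
  finish (suc p) = trans
    (lemma b (+ suc p) (+ suc q) (e (suc p) y *ℤ e (suc q) y) (e (suc (suc p)) y *ℤ e q y) (S y p (suc q)))
    (cong ((+ suc q -ℤ b) *ℤ (e (suc (suc p)) y *ℤ e q y) +ℤ_) (sym (S-step y p q)))
    where
    lemma : ∀ b p q r t s → (b -ℤ (+ 1 +ℤ p)) *ℤ r +ℤ (q -ℤ b) *ℤ t
      +ℤ ((+ 1 +ℤ q -ℤ b) *ℤ r +ℤ s) ≡ (q -ℤ b) *ℤ t +ℤ ((q -ℤ p) *ℤ r +ℤ s)
    lemma = solve-∀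

-- The contribution of the two cliques when v is coloured j, with b and c standing for b - 1 and c - 1.
cliques : (Fin N → ℤ) → Fin N → ℕ → ℕ → ℤ
cliques {N} x j b c = ∑ (allFin N) (λ i → (x ∖ j) i *ℤ (e b (x ∖ j ∖ i) *ℤ e c (x ∖ i)))

-- Only the second clique may reuse the colour `j`. Splitting off `x j` from its factor by
-- `e-remove⁻` leaves expressions in `x ∖ j` alone.
cliques≡S : ∀ (x : Fin N → ℤ) j b c → cliques x j b c ≡ S (x ∖ j) b c +ℤ x j *ℤ S⁻ (x ∖ j) c b
cliques≡S {N} x j b c = begin
  cliques x j b c
    ≡⟨ ∑-cong (allFin N) split ⟩
  ∑ (allFin N) (λ i → y i *ℤ (e b (y ∖ i) *ℤ e c (y ∖ i)) +ℤ x j *ℤ (y i *ℤ (e⁻ c (y ∖ i) *ℤ e b (y ∖ i))))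
    ≡⟨ trans (∑-+ (allFin N) _ _) (cong (S y b c +ℤ_) (∑-*ˡ (allFin N) (x j) _)) ⟩
  S y b c +ℤ x j *ℤ ∑ (allFin N) (λ i → y i *ℤ (e⁻ c (y ∖ i) *ℤ e b (y ∖ i)))
    ≡⟨ cong (λ s → S y b c +ℤ x j *ℤ s) (shifted c) ⟩
  S y b c +ℤ x j *ℤ S⁻ y c b ∎
  where
  y = x ∖ j
  shifted : ∀ c → ∑ (allFin N) (λ i → y i *ℤ (e⁻ c (y ∖ i) *ℤ e b (y ∖ i))) ≡ S⁻ y c b
  shifted zero    = trans (∑-cong (allFin N) (λ i → lemma (y i) (e b (y ∖ i)))) (∑-0 (allFin N))
    where
    lemma : ∀ a r → a *ℤ (+ 0 *ℤ r) ≡ + 0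
    lemma = solve-∀
  shifted (suc c) = refl
  split : ∀ i → y i *ℤ (e b (y ∖ i) *ℤ e c (x ∖ i)) ≡
    y i *ℤ (e b (y ∖ i) *ℤ e c (y ∖ i)) +ℤ x j *ℤ (y i *ℤ (e⁻ c (y ∖ i) *ℤ e b (y ∖ i)))
  split i with i Fin.≟ j
  -- At `i = j` the variable split off would be zero instead of `x j`, but the common factor `y i`
  -- vanishes.
  ... | yes refl rewrite ∖-self x i = sym (trans (ℤ.+-identityˡ _) (ℤ.*-zeroʳ (x i)))
  ... | no  i≢j = trans (cong (λ t → y i *ℤ (e b (y ∖ i) *ℤ t)) remove)
                    (lemma (y i) (e b (y ∖ i)) (e c (y ∖ i)) (e⁻ c (y ∖ i)) (x j))
    where
    e⁻-cong : ∀ k {u v : Fin N → ℤ} → u ≗ v → e⁻ k u ≡ e⁻ k v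
    e⁻-cong zero    _   = refl
    e⁻-cong (suc k) u≗v = e-cong k u≗v
    remove : e c (x ∖ i) ≡ e c (y ∖ i) +ℤ x j *ℤ e⁻ c (y ∖ i)
    remove = trans (e-remove⁻ c (x ∖ i) j)
      (cong₂ _+ℤ_ (e-cong c (∖-swap x i j)) (cong₂ _*ℤ_ (∖-other x i≢j) (e⁻-cong c (∖-swap x i j))))
    lemma : ∀ a r s t z → a *ℤ (r *ℤ (s +ℤ z *ℤ t)) ≡ a *ℤ (r *ℤ s) +ℤ z *ℤ (a *ℤ (t *ℤ r))
    lemma = solve-∀

-- In each product only one elementary factor depends on `j`. The signed coefficients are
-- nonnegative on the pairs used later, where `k ≤ b` and `suc b ≤ l`.
exchange : ℕ → (Fin N → ℤ) → Fin N → ℕ → ℕ → ℤ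
exchange b x j k l =
  (+ suc b -ℤ + k) *ℤ (e k x *ℤ e l (x ∖ j)) +ℤ (+ l -ℤ + suc b) *ℤ (e l x *ℤ e k (x ∖ j))

-- Splitting `x j` off the factor in all variables leaves coefficient (b - k) + (l - b) = l - k in
-- the part without `x j`, as in `S≡W`; the part with `x j` is the telescoping sum `W-shifted`.
W-exchange : ∀ b (x : Fin N → ℤ) j p q →
  W (exchange b x j) p q ≡
    S (x ∖ j) p q +ℤ x j *ℤ ((+ suc q -ℤ + suc b) *ℤ (e p (x ∖ j) *ℤ e q (x ∖ j)) +ℤ S⁻ (x ∖ j) p q)
W-exchange b x j p q = begin
  W (exchange b x j) p q
    ≡⟨ W-cong p q (λ k l _ _ _ → split k l) ⟩
  W (λ k l → (+ l -ℤ + k) *ℤ (e k y *ℤ e l y) +ℤ x j *ℤ shifted k l) p q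
    ≡⟨ trans (W-+ _ _ p q) (cong₂ _+ℤ_ (sym (S≡W y p q)) (W-*ˡ (x j) shifted p q)) ⟩
  S y p q +ℤ x j *ℤ W shifted p q
    ≡⟨ cong (λ t → S y p q +ℤ x j *ℤ t) (W-shifted (+ suc b) y p q) ⟩
  S y p q +ℤ x j *ℤ ((+ suc q -ℤ + suc b) *ℤ (e p y *ℤ e q y) +ℤ S⁻ y p q) ∎
  where
  y = x ∖ j
  shifted : ℕ → ℕ → ℤ
  shifted k l = (+ suc b -ℤ + k) *ℤ (e⁻ k y *ℤ e l y) +ℤ (+ l -ℤ + suc b) *ℤ (e k y *ℤ e⁻ l y)
  split : ∀ k l → exchange b x j k l ≡ (+ l -ℤ + k) *ℤ (e k y *ℤ e l y) +ℤ x j *ℤ shifted k l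
  split k l = trans
    (cong₂ (λ s t → (+ suc b -ℤ + k) *ℤ (s *ℤ e l y) +ℤ (+ l -ℤ + suc b) *ℤ (t *ℤ e k y))
      (e-remove⁻ k x j) (e-remove⁻ l x j))
    (lemma (+ suc b) (+ k) (+ l) (e k y) (e l y) (e⁻ k y) (e⁻ l y) (x j))
    where
    lemma : ∀ b k l r s r⁻ s⁻ z →
      (b -ℤ k) *ℤ ((r +ℤ z *ℤ r⁻) *ℤ s) +ℤ (l -ℤ b) *ℤ ((s +ℤ z *ℤ s⁻) *ℤ r) ≡
      (l -ℤ k) *ℤ (r *ℤ s) +ℤ z *ℤ ((b -ℤ k) *ℤ (r⁻ *ℤ s) +ℤ (l -ℤ b) *ℤ (r *ℤ s⁻))
    lemma = solve-∀

-- The coefficients of `x j` on the two sides are S at (c - 1, b) and S at (b - 1, c) plus the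
-- boundary term of `W-shifted`; one `S-step` accounts for the difference.
cliques≡W-≤ : ∀ (x : Fin N → ℤ) j b c → b ≤ c → cliques x j b c ≡ W (exchange b x j) b c
cliques≡W-≤ x j b c b≤c = trans (cliques≡S x j b c)
  (trans (cong (λ t → S y b c +ℤ x j *ℤ t) (recur b c b≤c)) (sym (W-exchange b x j b c)))
  where
  y = x ∖ j
  recur : ∀ b c → b ≤ c →
    S⁻ y c b ≡ (+ suc c -ℤ + suc b) *ℤ (e b y *ℤ e c y) +ℤ S⁻ y b c
  recur zero    zero    b≤c = refl
  recur zero    (suc c) b≤c = trans (S-comm y c 0) (trans (S-zero y c) (lemma (+ suc c) (e (suc c) y)))
    where
    lemma : ∀ c r → c *ℤ r ≡ (+ 1 +ℤ c -ℤ + 1) *ℤ (+ 1 *ℤ r) +ℤ + 0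
    lemma = solve-∀
  recur (suc b) (suc c) b≤c = trans (S-comm y c (suc b)) (trans (S-step y b c)
    (cong (λ t → t *ℤ (e (suc b) y *ℤ e (suc c) y) +ℤ S y b (suc c)) (lemma (+ suc b) (+ suc c))))
    where
    lemma : ∀ b c → c -ℤ b ≡ (+ 1 +ℤ c) -ℤ (+ 1 +ℤ b)
    lemma = solve-∀

-- With `p = c` and `q = b` the boundary coefficient is `suc b` minus itself, so the coefficients of
-- `x j` agree at once.
cliques≡W-≥ : ∀ (x : Fin N → ℤ) j b c → cliques x j b c ≡ W (exchange b x j) c b
cliques≡W-≥ x j b c = trans (cliques≡S x j b c)
  (trans (cong₂ (λ s t → s +ℤ x j *ℤ t) (S-comm (x ∖ j) b c)
           (lemma (+ suc b) (e c (x ∖ j) *ℤ e b (x ∖ j)) (S⁻ (x ∖ j) c b)))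
         (sym (W-exchange b x j c b)))
  where
  lemma : ∀ b r s → s ≡ (b -ℤ b) *ℤ r +ℤ s
  lemma = solve-∀

-- Paths and lollipops

∑-remove : ∀ (x f : Fin N → ℤ) j →
  ∑ (allFin N) (λ i → x i *ℤ f i) ≡ ∑ (allFin N) (λ i → (x ∖ j) i *ℤ f i) +ℤ x j *ℤ f j
∑-remove {suc N} x f zero    = begin
  ∑ (allFin (suc N)) (λ i → x i *ℤ f i)          ≡⟨ ∑-allFin-suc N _ ⟩
  x zero *ℤ f zero +ℤ rest                       ≡⟨ lemma (x zero) (f zero) rest ⟩
  + 0 *ℤ f zero +ℤ rest +ℤ x zero *ℤ f zero      ≡⟨ cong (_+ℤ x zero *ℤ f zero) (∑-allFin-suc N _) ⟨
  ∑ (allFin (suc N)) (λ i → (x ∖ zero) i *ℤ f i) +ℤ x zero *ℤ f zero ∎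
  where
  rest = ∑ (allFin N) (λ i → x (suc i) *ℤ f (suc i))
  lemma : ∀ a b r → a *ℤ b +ℤ r ≡ + 0 *ℤ b +ℤ r +ℤ a *ℤ b
  lemma = solve-∀
∑-remove {suc N} x f (suc j) = begin
  ∑ (allFin (suc N)) (λ i → x i *ℤ f i)
    ≡⟨ ∑-allFin-suc N _ ⟩
  x zero *ℤ f zero +ℤ ∑ (allFin N) (λ i → x (suc i) *ℤ f (suc i))
    ≡⟨ cong (x zero *ℤ f zero +ℤ_) (∑-remove (x ∘ suc) (f ∘ suc) j) ⟩
  x zero *ℤ f zero +ℤ (rest +ℤ x (suc j) *ℤ f (suc j))
    ≡⟨ ℤ.+-assoc (x zero *ℤ f zero) rest _ ⟨
  x zero *ℤ f zero +ℤ rest +ℤ x (suc j) *ℤ f (suc j)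
    ≡⟨ cong (_+ℤ x (suc j) *ℤ f (suc j)) (∑-allFin-suc N _) ⟨
  ∑ (allFin (suc N)) (λ i → (x ∖ suc j) i *ℤ f i) +ℤ x (suc j) *ℤ f (suc j) ∎
  where
  rest = ∑ (allFin N) (λ i → ((x ∘ suc) ∖ j) i *ℤ f (suc i))

-- The generating function of the colourings of a path of a new vertices attached at a vertex
-- coloured j.
pathGF : ℕ → (Fin N → ℤ) → Fin N → ℤ
pathGF zero    x j = + 1
pathGF (suc a) x j = ∑ (allFin _) (λ i → (x ∖ j) i *ℤ pathGF a x i)

-- Up to the factor m !, the chromatic function of a clique K_{m+1} with a path of length a attached.
lollipop : ℕ → ℕ → (Fin N → ℤ) → ℤ
lollipop m a x = ∑ (allFin _) (λ j → x j *ℤ (e m (x ∖ j) *ℤ pathGF a x j))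

lollipop-zero : ∀ m (x : Fin N → ℤ) → lollipop m 0 x ≡ + suc m *ℤ e (suc m) x
lollipop-zero m x =
  trans (∑-cong (allFin _) (λ j → cong (x j *ℤ_) (ℤ.*-identityʳ (e m (x ∖ j))))) (∑-e-remove m x)

-- Trades a path vertex for a clique vertex. By `∑-remove` the path factor is the whole sum `p`
-- minus the case that the first path vertex repeats the colour `j`; in that correction `x j` times
-- `e m (x ∖ j)` is the difference of `e (suc m) x` and `e (suc m) (x ∖ j)`. The coefficient `m` is
-- `suc m` from the main term minus 1 from the correction.
lollipop-suc : ∀ m a (x : Fin N → ℤ) →
  lollipop m (suc a) x ≡ + m *ℤ e (suc m) x *ℤ lollipop 0 a x +ℤ lollipop (suc m) a x
lollipop-suc {N} m a x = begin
  lollipop m (suc a) x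
    ≡⟨ ∑-cong (allFin N) (λ j → cross (x j) (e m (x ∖ j)) (pathGF (suc a) x j) (pathGF a x j)
                                  (e (suc m) (x ∖ j)) (∑-remove x (pathGF a x) j) (e-remove m x j)) ⟩
  ∑ (allFin N) (λ j → p *ℤ (x j *ℤ e m (x ∖ j)) +ℤ
    ((-ℤ e (suc m) x) *ℤ (x j *ℤ pathGF a x j) +ℤ x j *ℤ (e (suc m) (x ∖ j) *ℤ pathGF a x j)))
    ≡⟨ trans (∑-+ (allFin N) _ _) (cong₂ _+ℤ_
         (trans (∑-*ˡ (allFin N) p _) (cong (p *ℤ_) (∑-e-remove m x)))
         (trans (∑-+ (allFin N) _ _) (cong (_+ℤ lollipop (suc m) a x) (∑-*ˡ (allFin N) (-ℤ e (suc m) x) _)))) ⟩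
  p *ℤ (+ suc m *ℤ e (suc m) x) +ℤ ((-ℤ e (suc m) x) *ℤ p +ℤ lollipop (suc m) a x)
    ≡⟨ collect p (e (suc m) x) (+ m) (lollipop (suc m) a x) ⟩
  + m *ℤ e (suc m) x *ℤ p +ℤ lollipop (suc m) a x
    ≡⟨ cong (λ t → + m *ℤ e (suc m) x *ℤ t +ℤ lollipop (suc m) a x)
         (∑-cong (allFin N) (λ j → cong (x j *ℤ_) (sym (ℤ.*-identityˡ (pathGF a x j))))) ⟩
  + m *ℤ e (suc m) x *ℤ lollipop 0 a x +ℤ lollipop (suc m) a x ∎
  where
  p = ∑ (allFin N) (λ j → x j *ℤ pathGF a x j)
  cross : ∀ z r g f s {p q} → p ≡ g +ℤ z *ℤ f → q ≡ s +ℤ z *ℤ r →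
    z *ℤ (r *ℤ g) ≡ p *ℤ (z *ℤ r) +ℤ ((-ℤ q) *ℤ (z *ℤ f) +ℤ z *ℤ (s *ℤ f))
  cross z r g f s refl refl = lemma z r g f s
    where
    lemma : ∀ z r g f s → z *ℤ (r *ℤ g) ≡
      (g +ℤ z *ℤ f) *ℤ (z *ℤ r) +ℤ ((-ℤ (s +ℤ z *ℤ r)) *ℤ (z *ℤ f) +ℤ z *ℤ (s *ℤ f))
    lemma = solve-∀
  collect : ∀ p r m l → p *ℤ ((+ 1 +ℤ m) *ℤ r) +ℤ ((-ℤ r) *ℤ p +ℤ l) ≡ m *ℤ r *ℤ p +ℤ l
  collect = solve-∀

-- Colourings

differ : Fin N → Fin N → Bool
differ i j = not (does (i Fin.≟ j))

∖-differ : ∀ (x : Fin N → ℤ) i j → (x ∖ i) j ≡ ⟦ differ i j ⟧ *ℤ x j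
∖-differ x i j with does (i Fin.≟ j)
... | true  = refl
... | false = sym (ℤ.*-identityˡ (x j))

fresh : Fin N → Vec (Fin N) m → Bool
fresh y []       = true
fresh y (z ∷ zs) = differ y z ∧ fresh y zs

distinct : Vec (Fin N) m → Bool
distinct []       = true
distinct (z ∷ zs) = fresh z zs ∧ distinct zs

walk : Fin N → Vec (Fin N) m → Bool
walk y []       = true
walk y (z ∷ zs) = differ y z ∧ walk z zs

weight : (Fin N → ℤ) → Vec (Fin N) m → ℤ
weight x []       = + 1
weight x (z ∷ zs) = x z *ℤ weight x zs

weight-++ : ∀ {k} (x : Fin N → ℤ) (κ : Vec (Fin N) m) (μ : Vec (Fin N) k) →
  weight x (κ ++ μ) ≡ weight x κ *ℤ weight x μ
weight-++ x []      μ = sym (ℤ.*-identityˡ _)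
weight-++ x (z ∷ κ) μ = trans (cong (x z *ℤ_) (weight-++ x κ μ)) (sym (ℤ.*-assoc (x z) _ _))

-- Turns the condition of avoiding a colour into the removal of a variable, so that several such
-- conditions become nested removals.
weight-fresh : ∀ (x : Fin N → ℤ) y (κ : Vec (Fin N) m) → weight (x ∖ y) κ ≡ ⟦ fresh y κ ⟧ *ℤ weight x κ
weight-fresh x y []      = refl
weight-fresh x y (z ∷ κ) = begin
  (x ∖ y) z *ℤ weight (x ∖ y) κ
    ≡⟨ cong₂ _*ℤ_ (∖-differ x y z) (weight-fresh x y κ) ⟩
  ⟦ differ y z ⟧ *ℤ x z *ℤ (⟦ fresh y κ ⟧ *ℤ weight x κ)
    ≡⟨ lemma ⟦ differ y z ⟧ (x z) ⟦ fresh y κ ⟧ (weight x κ) ⟩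
  ⟦ differ y z ⟧ *ℤ ⟦ fresh y κ ⟧ *ℤ (x z *ℤ weight x κ)
    ≡⟨ cong (_*ℤ (x z *ℤ weight x κ)) (⟦∧⟧ (differ y z) (fresh y κ)) ⟨
  ⟦ differ y z ∧ fresh y κ ⟧ *ℤ (x z *ℤ weight x κ) ∎
  where
  lemma : ∀ a b c d → a *ℤ b *ℤ (c *ℤ d) ≡ a *ℤ c *ℤ (b *ℤ d)
  lemma = solve-∀

colourings : ∀ N m → List (Vec (Fin N) m)
colourings N m = allVecs (allFin N) m

∑-colourings-suc : ∀ N m f →
  ∑ (colourings N (suc m)) f ≡ ∑ (allFin N) (λ z → ∑ (colourings N m) (λ κ → f (z ∷ κ)))
∑-colourings-suc N = ∑-allVecs-suc (allFin N)

∑-colourings-+ : ∀ N k m (f : Vec (Fin N) (k + m) → ℤ) →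
  ∑ (colourings N (k + m)) f ≡ ∑ (colourings N k) (λ κ → ∑ (colourings N m) (λ μ → f (κ ++ μ)))
∑-colourings-+ N zero    m f = sym (∑-single _)
  where
  ∑-single : ∀ (g : Vec (Fin N) 0 → ℤ) → ∑ (colourings N 0) g ≡ g []
  ∑-single g = trans (∑-∷ [] _ g) (trans (cong (g [] +ℤ_) (∑-[] g)) (ℤ.+-identityʳ (g [])))
∑-colourings-+ N (suc k) m f = begin
  ∑ (colourings N (suc k + m)) f
    ≡⟨ ∑-colourings-suc N (k + m) f ⟩
  ∑ (allFin N) (λ z → ∑ (colourings N (k + m)) (λ κ → f (z ∷ κ)))
    ≡⟨ ∑-cong (allFin N) (λ z → ∑-colourings-+ N k m (λ κ → f (z ∷ κ))) ⟩
  ∑ (allFin N) (λ z → ∑ (colourings N k) (λ κ → ∑ (colourings N m) (λ μ → f (z ∷ κ ++ μ))))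
    ≡⟨ ∑-colourings-suc N k _ ⟨
  ∑ (colourings N (suc k)) (λ κ → ∑ (colourings N m) (λ μ → f (κ ++ μ))) ∎

-- Every set of `m` colours is listed in `m !` orders. The induction fixes the first colour, and
-- each use of `∑-e-remove` supplies one factor of the factorial.
∑-distinct : ∀ m (x : Fin N → ℤ) →
  ∑ (colourings N m) (λ κ → ⟦ distinct κ ⟧ *ℤ weight x κ) ≡ + (m !) *ℤ e m x
∑-distinct {N} zero    x = trans (∑-∷ [] _ _) (cong (+ 1 +ℤ_) (∑-[] _))
∑-distinct {N} (suc m) x = begin
  ∑ (colourings N (suc m)) (λ κ → ⟦ distinct κ ⟧ *ℤ weight x κ)
    ≡⟨ ∑-colourings-suc N m _ ⟩
  ∑ (allFin N) (λ z → ∑ (colourings N m) (λ κ → ⟦ fresh z κ ∧ distinct κ ⟧ *ℤ (x z *ℤ weight x κ)))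
    ≡⟨ ∑-cong (allFin N) (λ z → trans (∑-cong (colourings N m) (step z))
         (trans (∑-*ˡ (colourings N m) (x z) _) (cong (x z *ℤ_) (∑-distinct m (x ∖ z))))) ⟩
  ∑ (allFin N) (λ z → x z *ℤ (+ (m !) *ℤ e m (x ∖ z)))
    ≡⟨ ∑-cong (allFin N) (λ z → swap (x z) (+ (m !)) (e m (x ∖ z))) ⟩
  ∑ (allFin N) (λ z → + (m !) *ℤ (x z *ℤ e m (x ∖ z)))
    ≡⟨ trans (∑-*ˡ (allFin N) (+ (m !)) _) (cong (+ (m !) *ℤ_) (∑-e-remove m x)) ⟩
  + (m !) *ℤ (+ suc m *ℤ e (suc m) x)
    ≡⟨ trans (rotate (+ (m !)) (+ suc m) (e (suc m) x)) (cong (_*ℤ e (suc m) x) (sym (ℤ.pos-* (suc m) (m !)))) ⟩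
  + (suc m !) *ℤ e (suc m) x ∎
  where
  swap : ∀ a b c → a *ℤ (b *ℤ c) ≡ b *ℤ (a *ℤ c)
  swap = solve-∀
  rotate : ∀ a b c → a *ℤ (b *ℤ c) ≡ b *ℤ a *ℤ c
  rotate = solve-∀
  step : ∀ z κ → ⟦ fresh z κ ∧ distinct κ ⟧ *ℤ (x z *ℤ weight x κ)
    ≡ x z *ℤ (⟦ distinct κ ⟧ *ℤ weight (x ∖ z) κ)
  step z κ rewrite ⟦∧⟧ (fresh z κ) (distinct κ) | weight-fresh x z κ =
    lemma ⟦ fresh z κ ⟧ ⟦ distinct κ ⟧ (x z) (weight x κ)
    where
    lemma : ∀ f d z w → f *ℤ d *ℤ (z *ℤ w) ≡ z *ℤ (d *ℤ (f *ℤ w))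
    lemma = solve-∀

∑-walk : ∀ a (x : Fin N → ℤ) j →
  ∑ (colourings N a) (λ κ → ⟦ walk j κ ⟧ *ℤ weight x κ) ≡ pathGF a x j
∑-walk {N} zero    x j = trans (∑-∷ [] _ _) (cong (+ 1 +ℤ_) (∑-[] _))
∑-walk {N} (suc a) x j = trans (∑-colourings-suc N a _) (∑-cong (allFin N) (λ z →
  trans (∑-cong (colourings N a) (step z))
    (trans (∑-*ˡ (colourings N a) ((x ∖ j) z) _) (cong ((x ∖ j) z *ℤ_) (∑-walk a x z)))))
  where
  step : ∀ z κ → ⟦ differ j z ∧ walk z κ ⟧ *ℤ (x z *ℤ weight x κ)
    ≡ (x ∖ j) z *ℤ (⟦ walk z κ ⟧ *ℤ weight x κ)
  step z κ rewrite ⟦∧⟧ (differ j z) (walk z κ) | ∖-differ x j z =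
    lemma ⟦ differ j z ⟧ ⟦ walk z κ ⟧ (x z) (weight x κ)
    where
    lemma : ∀ d f z w → d *ℤ f *ℤ (z *ℤ w) ≡ d *ℤ z *ℤ (f *ℤ w)
    lemma = solve-∀

-- w is coloured i, v is coloured j, and α, β, γ colour the remaining vertices of K_{b+1}, of K_c and
-- of the path.
admissible : ∀ {a b c} → Fin N → Vec (Fin N) b → Fin N → Vec (Fin N) c → Vec (Fin N) a → Bool
admissible i α j β γ =
  differ j i ∧ (fresh i α ∧ fresh j α ∧ distinct α) ∧ (fresh i β ∧ distinct β) ∧ walk j γ

∑-∑-* : ∀ (xs : List X) (ys : List Y) k f g →
  ∑ xs (λ s → ∑ ys (λ t → k *ℤ (f s *ℤ g t))) ≡ k *ℤ (∑ xs f *ℤ ∑ ys g)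
∑-∑-* xs ys k f g = begin
  ∑ xs (λ s → ∑ ys (λ t → k *ℤ (f s *ℤ g t)))
    ≡⟨ ∑-cong xs (λ s → trans (∑-*ˡ ys k _) (cong (k *ℤ_) (∑-*ˡ ys (f s) g))) ⟩
  ∑ xs (λ s → k *ℤ (f s *ℤ ∑ ys g))
    ≡⟨ trans (∑-*ˡ xs k _) (cong (k *ℤ_) (∑-*ʳ xs (∑ ys g) f)) ⟩
  k *ℤ (∑ xs f *ℤ ∑ ys g) ∎

-- Once `i` and `j` are fixed, the conditions on `α`, `β` and `γ` are independent and the sum
-- factors. The graph enters only through the hypothesis on `P`, and the vector is cut in the order
-- of the vertex numbering.
∑-admissible : ∀ a b c (x : Fin N → ℤ) (P : Vec (Fin N) (suc (b + suc (c + a))) → Bool) →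
  (∀ i (α : Vec (Fin N) b) j (β : Vec (Fin N) c) γ → P (i ∷ α ++ j ∷ β ++ γ) ≡ admissible i α j β γ) →
  ∑ (colourings N _) (λ κ → ⟦ P κ ⟧ *ℤ weight x κ)
    ≡ + (b ! * c !) *ℤ ∑ (allFin N) (λ j → x j *ℤ (cliques x j b c *ℤ pathGF a x j))
∑-admissible {N} a b c x P P≡ = begin
  ∑ (colourings N _) (λ κ → ⟦ P κ ⟧ *ℤ weight x κ)
    ≡⟨ ∑-colourings-suc N _ _ ⟩
  ∑ (allFin N) (λ i → ∑ (colourings N _) (λ κ → ⟦ P (i ∷ κ) ⟧ *ℤ weight x (i ∷ κ)))
    ≡⟨ ∑-cong (allFin N) (λ i → trans (∑-colourings-+ N b (suc (c + a)) _)
         (∑-cong (colourings N b) (λ α → trans (∑-colourings-suc N (c + a) _)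
           (∑-cong (allFin N) (λ j → trans (∑-colourings-+ N c a _)
             (∑-cong (colourings N c) (λ β → ∑-cong (colourings N a) (λ γ → factor i α j β γ)))))))) ⟩
  ∑ (allFin N) (λ i → ∑ (colourings N b) (λ α → ∑ (allFin N) (λ j →
    ∑ (colourings N c) (λ β → ∑ (colourings N a) (λ γ →
      u i j *ℤ f i j α *ℤ (g i β *ℤ h j γ))))))
    ≡⟨ ∑-cong (allFin N) (λ i → trans
         (∑-cong (colourings N b) (λ α → ∑-cong (allFin N) (λ j →
           ∑-∑-* (colourings N c) (colourings N a) (u i j *ℤ f i j α) (g i) (h j))))
         (∑-swap (colourings N b) (allFin N) _)) ⟩
  ∑ (allFin N) (λ i → ∑ (allFin N) (λ j → ∑ (colourings N b) (λ α →
    u i j *ℤ f i j α *ℤ (∑ (colourings N c) (g i) *ℤ ∑ (colourings N a) (h j)))))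
    ≡⟨ ∑-cong (allFin N) (λ i → ∑-cong (allFin N) (λ j → evaluate i j)) ⟩
  ∑ (allFin N) (λ i → ∑ (allFin N) (λ j →
    + (b ! * c !) *ℤ (x j *ℤ (term i j *ℤ pathGF a x j))))
    ≡⟨ ∑-swap (allFin N) (allFin N) _ ⟩
  ∑ (allFin N) (λ j → ∑ (allFin N) (λ i →
    + (b ! * c !) *ℤ (x j *ℤ (term i j *ℤ pathGF a x j))))
    ≡⟨ ∑-cong (allFin N) (λ j → trans (∑-*ˡ (allFin N) (+ (b ! * c !)) _)
         (cong (+ (b ! * c !) *ℤ_) (trans (∑-*ˡ (allFin N) (x j) _)
           (cong (x j *ℤ_) (∑-*ʳ (allFin N) (pathGF a x j) (λ i → term i j)))))) ⟩
  ∑ (allFin N) (λ j → + (b ! * c !) *ℤ (x j *ℤ (cliques x j b c *ℤ pathGF a x j)))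
    ≡⟨ ∑-*ˡ (allFin N) (+ (b ! * c !)) _ ⟩
  + (b ! * c !) *ℤ ∑ (allFin N) (λ j → x j *ℤ (cliques x j b c *ℤ pathGF a x j)) ∎
  where
  u : Fin N → Fin N → ℤ
  u i j = (x ∖ j) i *ℤ x j
  f : Fin N → Fin N → Vec (Fin N) b → ℤ
  f i j α = ⟦ distinct α ⟧ *ℤ weight (x ∖ j ∖ i) α
  g : Fin N → Vec (Fin N) c → ℤ
  g i β = ⟦ distinct β ⟧ *ℤ weight (x ∖ i) β
  h : Fin N → Vec (Fin N) a → ℤ
  h j γ = ⟦ walk j γ ⟧ *ℤ weight x γ
  term : Fin N → Fin N → ℤ
  term i j = (x ∖ j) i *ℤ (e b (x ∖ j ∖ i) *ℤ e c (x ∖ i))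
  factor : ∀ i (α : Vec (Fin N) b) j (β : Vec (Fin N) c) (γ : Vec (Fin N) a) →
    ⟦ P (i ∷ α ++ j ∷ β ++ γ) ⟧ *ℤ weight x (i ∷ α ++ j ∷ β ++ γ)
      ≡ u i j *ℤ f i j α *ℤ (g i β *ℤ h j γ)
  factor i α j β γ
    rewrite P≡ i α j β γ
          | weight-++ x α (j ∷ β ++ γ) | weight-++ x β γ
          | ∖-differ x j i
          | weight-fresh (x ∖ j) i α | weight-fresh x j α | weight-fresh x i β
          | ⟦∧⟧ (differ j i) ((fresh i α ∧ fresh j α ∧ distinct α) ∧ (fresh i β ∧ distinct β) ∧ walk j γ)
          | ⟦∧⟧ (fresh i α ∧ fresh j α ∧ distinct α) ((fresh i β ∧ distinct β) ∧ walk j γ)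
          | ⟦∧⟧ (fresh i α) (fresh j α ∧ distinct α) | ⟦∧⟧ (fresh j α) (distinct α)
          | ⟦∧⟧ (fresh i β ∧ distinct β) (walk j γ) | ⟦∧⟧ (fresh i β) (distinct β)
    = lemma ⟦ differ j i ⟧ ⟦ fresh i α ⟧ ⟦ fresh j α ⟧ ⟦ distinct α ⟧ ⟦ fresh i β ⟧ ⟦ distinct β ⟧
            ⟦ walk j γ ⟧ (x i) (weight x α) (x j) (weight x β) (weight x γ)
    where
    lemma : ∀ d fi fj da fb db w xi wa xj wb wc →
      d *ℤ (fi *ℤ (fj *ℤ da) *ℤ (fb *ℤ db *ℤ w)) *ℤ (xi *ℤ (wa *ℤ (xj *ℤ (wb *ℤ wc)))) ≡
      d *ℤ xi *ℤ xj *ℤ (da *ℤ (fi *ℤ (fj *ℤ wa))) *ℤ (db *ℤ (fb *ℤ wb) *ℤ (w *ℤ wc))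
    lemma = solve-∀
  evaluate : ∀ i j →
    ∑ (colourings N b) (λ α → u i j *ℤ f i j α *ℤ (∑ (colourings N c) (g i) *ℤ ∑ (colourings N a) (h j)))
      ≡ + (b ! * c !) *ℤ (x j *ℤ (term i j *ℤ pathGF a x j))
  evaluate i j = begin
    ∑ (colourings N b) (λ α → u i j *ℤ f i j α *ℤ (∑ (colourings N c) (g i) *ℤ ∑ (colourings N a) (h j)))
      ≡⟨ trans (∑-*ʳ (colourings N b) _ _) (cong₂ _*ℤ_
           (trans (∑-*ˡ (colourings N b) (u i j) _) (cong (u i j *ℤ_) (∑-distinct b (x ∖ j ∖ i))))
           (cong₂ _*ℤ_ (∑-distinct c (x ∖ i)) (∑-walk a x j))) ⟩
    u i j *ℤ (+ (b !) *ℤ e b (x ∖ j ∖ i)) *ℤ (+ (c !) *ℤ e c (x ∖ i) *ℤ pathGF a x j)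
      ≡⟨ lemma ((x ∖ j) i) (x j) (+ (b !)) (e b (x ∖ j ∖ i)) (+ (c !)) (e c (x ∖ i)) (pathGF a x j) ⟩
    + (b !) *ℤ + (c !) *ℤ (x j *ℤ (term i j *ℤ pathGF a x j))
      ≡⟨ cong (_*ℤ (x j *ℤ (term i j *ℤ pathGF a x j))) (sym (ℤ.pos-* (b !) (c !))) ⟩
    + (b ! * c !) *ℤ (x j *ℤ (term i j *ℤ pathGF a x j)) ∎
    where
    lemma : ∀ xi xj b! eb c! ec p →
      xi *ℤ xj *ℤ (b! *ℤ eb) *ℤ (c! *ℤ ec *ℤ p) ≡ b! *ℤ c! *ℤ (xj *ℤ (xi *ℤ (eb *ℤ ec) *ℤ p))
    lemma = solve-∀

-- Proper colourings of the graph

T-⇔⇒≡ : ∀ {p q} → (T p → T q) → (T q → T p) → p ≡ q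
T-⇔⇒≡ {p} {q} f g = ⇔→≡ (mk⇔ (to T-≡ ∘ f ∘ from (T-≡ {p})) (to T-≡ ∘ g ∘ from (T-≡ {q})))

-- Positions are natural numbers, not elements of `Fin m`, so that they add up along `_++_` without
-- casts and compare directly with the numbers in `edgeℕ`.
data At {X : Set} : ∀ {m} → Vec X m → ℕ → X → Set where
  here  : ∀ {m z} {κ : Vec X m} → At (z ∷ κ) 0 z
  there : ∀ {m y z k} {κ : Vec X m} → At κ k z → At (y ∷ κ) (suc k) z

module _ {X : Set} where

  At-lookup : ∀ (κ : Vec X m) u → At κ (toℕ u) (lookup κ u)
  At-lookup (z ∷ κ) zero    = here
  At-lookup (z ∷ κ) (suc u) = there (At-lookup κ u)

  At⇒lookup : ∀ {κ : Vec X m} {k z} → At κ k z → ∃ λ u → toℕ u ≡ k × lookup κ u ≡ z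
  At⇒lookup here      = zero , refl , refl
  At⇒lookup (there p) with u , refl , refl ← At⇒lookup p = suc u , refl , refl

  At-< : ∀ {κ : Vec X m} {k z} → At κ k z → k < m
  At-< here      = s≤s z≤n
  At-< (there p) = s≤s (At-< p)

  At-unique : ∀ {κ : Vec X m} {k y z} → At κ k y → At κ k z → y ≡ z
  At-unique here      here      = refl
  At-unique (there p) (there q) = At-unique p q

  At-++ˡ : ∀ {κ : Vec X m} {μ : Vec X l} {k z} → At κ k z → At (κ ++ μ) k z
  At-++ˡ here      = here
  At-++ˡ (there p) = there (At-++ˡ p)

  At-++ʳ : ∀ (κ : Vec X m) {μ : Vec X l} {k z} → At μ k z → At (κ ++ μ) (m + k) z
  At-++ʳ []      p = p
  At-++ʳ (_ ∷ κ) p = there (At-++ʳ κ p)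

  At-++⁻ : ∀ (κ : Vec X m) {μ : Vec X l} {k z} → At (κ ++ μ) k z →
    At κ k z ⊎ (∃ λ k′ → k ≡ m + k′ × At μ k′ z)
  At-++⁻ []      p         = inj₂ (_ , refl , p)
  At-++⁻ (_ ∷ κ) here      = inj₁ here
  At-++⁻ (_ ∷ κ) (there p) with At-++⁻ κ p
  ... | inj₁ q              = inj₁ (there q)
  ... | inj₂ (k′ , refl , q) = inj₂ (k′ , refl , q)

differ⇒≢ : ∀ {i j : Fin N} → T (differ i j) → i ≢ j
differ⇒≢ {i = i} {j} t with i Fin.≟ j
... | no i≢j = i≢j

≢⇒differ : ∀ {i j : Fin N} → i ≢ j → T (differ i j)
≢⇒differ {i = i} {j} i≢j with i Fin.≟ j
... | yes i≡j = i≢j i≡j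
... | no  _   = tt

fresh⇒≢ : ∀ {y z : Fin N} {κ : Vec (Fin N) m} → T (fresh y κ) → At κ k z → y ≢ z
fresh⇒≢ t here      = differ⇒≢ (proj₁ (to T-∧ t))
fresh⇒≢ t (there p) = fresh⇒≢ (proj₂ (to T-∧ t)) p

≢⇒fresh : ∀ {y : Fin N} (κ : Vec (Fin N) m) → (∀ {k z} → At κ k z → y ≢ z) → T (fresh y κ)
≢⇒fresh []      ≢ = tt
≢⇒fresh (z ∷ κ) ≢ = from T-∧ (≢⇒differ (≢ here) , ≢⇒fresh κ (≢ ∘ there))

distinct⇒≢ : ∀ {y z : Fin N} {κ : Vec (Fin N) m} → T (distinct κ) →
  At κ k y → At κ l z → k < l → y ≢ z
distinct⇒≢ t here      (there q) k<l       = fresh⇒≢ (proj₁ (to T-∧ t)) q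
distinct⇒≢ t (there p) (there q) (s≤s k<l) = distinct⇒≢ (proj₂ (to T-∧ t)) p q k<l

≢⇒distinct : ∀ (κ : Vec (Fin N) m) → (∀ {k l y z} → At κ k y → At κ l z → k < l → y ≢ z) →
  T (distinct κ)
≢⇒distinct []      ≢ = tt
≢⇒distinct (z ∷ κ) ≢ = from T-∧
  ( ≢⇒fresh κ (λ q → ≢ here (there q) (s≤s z≤n))
  , ≢⇒distinct κ (λ p q k<l → ≢ (there p) (there q) (s≤s k<l)))

walk⇒≢ : ∀ {j y z : Fin N} {κ : Vec (Fin N) m} → T (walk j κ) →
  At (j ∷ κ) k y → At κ k z → y ≢ z
walk⇒≢ t here      here      = differ⇒≢ (proj₁ (to T-∧ t))
walk⇒≢ t (there p) (there q) = walk⇒≢ (proj₂ (to T-∧ t)) p q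

≢⇒walk : ∀ {j : Fin N} (κ : Vec (Fin N) m) → (∀ {k y z} → At (j ∷ κ) k y → At κ k z → y ≢ z) →
  T (walk j κ)
≢⇒walk []      ≢ = tt
≢⇒walk (z ∷ κ) ≢ = from T-∧ (≢⇒differ (≢ here here) , ≢⇒walk κ (λ p q → ≢ (there p) (there q)))

all-allFin⇒ : ∀ (p : Fin m → Bool) → T (all p (allFin m)) → ∀ u → T (p u)
all-allFin⇒ p t = All.tabulate⁻ (All.all⁺ p _ t)

⇒all-allFin : ∀ (p : Fin m → Bool) → (∀ u → T (p u)) → T (all p (allFin m))
⇒all-allFin p t = All.all⁻ p (All.tabulate⁺ t)

data Edge (b c k l : ℕ) : Set where
  clique₁ : l ≤ b → Edge b c k l
  clique₂ : k ≡ 0 ⊎ b < k → b < l → l ≤ b + c ∸ 1 → Edge b c k l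
  hook    : k ≡ b → l ≡ b + c → Edge b c k l
  link    : b + c ≤ k → l ≡ suc k → Edge b c k l

edge⇒ : ∀ b c {k l} → T (edgeℕ b c k l) → k < l × Edge b c k l
edge⇒ b c {k} {l} t with to T-∧ t
... | k<l , t₁ = ℕ.<ᵇ⇒< k l k<l , edge (to T-∨ t₁)
  where
  edge : _ → Edge b c k l
  edge (inj₁ p) = clique₁ (ℕ.≤ᵇ⇒≤ l b p)
  edge (inj₂ t₂) with to T-∨ t₂
  ... | inj₁ p with to T-∧ p
  ...   | q , r with to T-∧ r
  ...     | b<l , l≤ = clique₂ (first (to T-∨ q)) (ℕ.≤ᵇ⇒≤ _ l b<l) (ℕ.≤ᵇ⇒≤ l _ l≤)
    where
    first : _ → k ≡ 0 ⊎ b < k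
    first (inj₁ p) = inj₁ (ℕ.≡ᵇ⇒≡ k 0 p)
    first (inj₂ p) = inj₂ (ℕ.≤ᵇ⇒≤ _ k p)
  edge (inj₂ t₂) | inj₂ t₃ with to T-∨ t₃
  ... | inj₁ p = hook (ℕ.≡ᵇ⇒≡ k b (proj₁ (to T-∧ p))) (ℕ.≡ᵇ⇒≡ l _ (proj₂ (to T-∧ p)))
  ... | inj₂ p = link (ℕ.≤ᵇ⇒≤ _ k (proj₁ (to T-∧ p))) (ℕ.≡ᵇ⇒≡ l _ (proj₂ (to T-∧ p)))

⇒edge : ∀ {b c k l} → k < l → Edge b c k l → T (edgeℕ b c k l)
⇒edge {b} {c} {k} {l} k<l ed = from T-∧ (ℕ.<⇒<ᵇ k<l , kind ed)
  where
  e₂ e₃ e₄ : Bool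
  e₂ = ((k ≡ᵇ 0) ∨ (suc b ≤ᵇ k)) ∧ (suc b ≤ᵇ l) ∧ (l ≤ᵇ b + c ∸ 1)
  e₃ = (k ≡ᵇ b) ∧ (l ≡ᵇ b + c)
  e₄ = (b + c ≤ᵇ k) ∧ (l ≡ᵇ suc k)
  ∨ˡ : ∀ {p} q → T p → T (p ∨ q)
  ∨ˡ {p} q t = from (T-∨ {p} {q}) (inj₁ t)
  ∨ʳ : ∀ p {q} → T q → T (p ∨ q)
  ∨ʳ p t = from (T-∨ {p}) (inj₂ t)
  first : k ≡ 0 ⊎ b < k → T ((k ≡ᵇ 0) ∨ (suc b ≤ᵇ k))
  first (inj₁ k≡0) = ∨ˡ (suc b ≤ᵇ k) (ℕ.≡⇒≡ᵇ k 0 k≡0)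
  first (inj₂ b<k) = ∨ʳ (k ≡ᵇ 0) (ℕ.≤⇒≤ᵇ b<k)
  kind : Edge b c k l → T ((l ≤ᵇ b) ∨ e₂ ∨ e₃ ∨ e₄)
  kind (clique₁ p)     = ∨ˡ (e₂ ∨ e₃ ∨ e₄) (ℕ.≤⇒≤ᵇ p)
  kind (clique₂ p q r) = ∨ʳ (l ≤ᵇ b) (∨ˡ (e₃ ∨ e₄)
    (from T-∧ (first p , from (T-∧ {suc b ≤ᵇ l}) (ℕ.≤⇒≤ᵇ q , ℕ.≤⇒≤ᵇ r))))
  kind (hook p q)      = ∨ʳ (l ≤ᵇ b) (∨ʳ e₂ (∨ˡ e₄ (from T-∧ (ℕ.≡⇒≡ᵇ k b p , ℕ.≡⇒≡ᵇ l _ q))))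
  kind (link p q)      = ∨ʳ (l ≤ᵇ b) (∨ʳ e₂ (∨ʳ e₃
    (from (T-∧ {b + c ≤ᵇ k}) (ℕ.≤⇒≤ᵇ p , ℕ.≡⇒≡ᵇ l _ q))))

-- The number of vertices is a separate parameter, so that it can be rewritten by congruence to the
-- length of the cut vector; at `m = a + b + c` this is `G5p4 a b c` by definition.
edgeGraph : ∀ b c m → Graph m
edgeGraph b c m u v = edgeℕ b c (toℕ u) (toℕ v) ∨ edgeℕ b c (toℕ v) (toℕ u)

Proper : ∀ b c → Vec (Fin N) m → Set
Proper b c κ = ∀ {k l y z} → At κ k y → At κ l z → k < l → Edge b c k l → y ≢ z

proper⇒Proper : ∀ b c (κ : Vec (Fin N) m) → T (proper (edgeGraph b c m) κ) → Proper b c κ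
proper⇒Proper {m = m} b c κ t p q k<l ed y≡z
  with u , refl , refl ← At⇒lookup p | v , refl , refl ← At⇒lookup q
  with t′ ← all-allFin⇒ _ (all-allFin⇒ _ t u) v
  with edgeℕ b c (toℕ u) (toℕ v) | ⇒edge k<l ed | lookup κ u Fin.≟ lookup κ v
... | true | tt | no y≢z = y≢z y≡z

Proper⇒proper : ∀ b c (κ : Vec (Fin N) m) → Proper b c κ → T (proper (edgeGraph b c m) κ)
Proper⇒proper {m = m} b c κ P = ⇒all-allFin _ (λ u → ⇒all-allFin _ (λ v → ok u v))
  where
  ok : ∀ u v → T (not (edgeGraph b c m u v) ∨ not ⌊ lookup κ u Fin.≟ lookup κ v ⌋)
  ok u v with lookup κ u Fin.≟ lookup κ v
  ... | no  _   = from T-∨ (inj₂ tt)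
  ... | yes y≡z = from (T-∨ {not (edgeGraph b c m u v)}) (inj₁ (nonadjacent (no-edge u v y≡z) (no-edge v u (sym y≡z))))
    where
    no-edge : ∀ u v → lookup κ u ≡ lookup κ v → ¬ T (edgeℕ b c (toℕ u) (toℕ v))
    no-edge u v y≡z t with edge⇒ b c t
    ... | k<l , ed = P (At-lookup κ u) (At-lookup κ v) k<l ed y≡z
    nonadjacent : ∀ {p q} → ¬ T p → ¬ T q → T (not (p ∨ q))
    nonadjacent {true}          ¬p ¬q = ¬p tt
    nonadjacent {false} {true}  ¬p ¬q = ¬q tt
    nonadjacent {false} {false} ¬p ¬q = tt

-- Vertex blocks and the conditions they impose

module _ {a b c} (i : Fin N) (α : Vec (Fin N) b) (j : Fin N) (β : Vec (Fin N) c) (γ : Vec (Fin N) a) where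

  κ : Vec (Fin N) (suc (b + suc (c + a)))
  κ = i ∷ α ++ j ∷ β ++ γ

  -- One constructor per block of the vertex numbering; `position` and `unposition` settle the index
  -- arithmetic, so that adjacency becomes a case analysis on blocks.
  data Position : ℕ → Fin N → Set where
    at-w : Position 0 i
    in-α : ∀ {k z} → At α k z → Position (suc k) z
    at-v : Position (suc b) j
    in-β : ∀ {k z} → At β k z → Position (suc b + suc k) z
    in-γ : ∀ {k z} → At γ k z → Position (suc b + suc c + k) z

  position : ∀ {k z} → At κ k z → Position k z
  position here = at-w
  position {z = z} (there p) with At-++⁻ α p
  ... | inj₁ q = in-α q
  ... | inj₂ (_ , refl , here) = subst (λ k → Position (suc k) j) (sym (ℕ.+-identityʳ b)) at-v
  ... | inj₂ (_ , refl , there q) with At-++⁻ β q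
  ...   | inj₁ r = in-β r
  ...   | inj₂ (k , refl , r) = subst (λ k → Position (suc k) z) (ℕ.+-assoc b (suc c) k) (in-γ r)

  unposition : ∀ {k z} → Position k z → At κ k z
  unposition at-w     = here
  unposition (in-α p) = there (At-++ˡ p)
  unposition at-v     = there (subst (λ k → At (α ++ j ∷ β ++ γ) k j) (ℕ.+-identityʳ b) (At-++ʳ α here))
  unposition (in-β p) = there (At-++ʳ α (there (At-++ˡ p)))
  unposition (in-γ {k} {z} p) =
    there (subst (λ k → At (α ++ j ∷ β ++ γ) k z) (sym (ℕ.+-assoc b (suc c) k)) (At-++ʳ α (there (At-++ʳ β p))))

  Proper⇒admissible : Proper (suc b) (suc c) κ → T (admissible i α j β γ)
  Proper⇒admissible P = from T-∧ (≢⇒differ j≢i , from T-∧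
    ( from T-∧ (≢⇒fresh α i≢α , from T-∧ (≢⇒fresh α j≢α , ≢⇒distinct α α≢α))
    , from T-∧ (from T-∧ (≢⇒fresh β i≢β , ≢⇒distinct β β≢β) , ≢⇒walk γ γ≢γ)))
    where
    P′ : ∀ {k l y z} → Position k y → Position l z → k < l → Edge (suc b) (suc c) k l → y ≢ z
    P′ p q = P (unposition p) (unposition q)
    last : ∀ {k z} → At β k z → suc b + suc k ≤ suc b + suc c ∸ 1
    last p = ℕ.≤-trans (s≤s (ℕ.+-monoʳ-≤ b (At-< p))) (ℕ.≤-reflexive (sym (ℕ.+-suc b c)))
    j≢i : j ≢ i
    j≢i = P′ at-w at-v (s≤s z≤n) (clique₁ ℕ.≤-refl) ∘ sym
    i≢α : ∀ {k z} → At α k z → i ≢ z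
    i≢α p = P′ at-w (in-α p) (s≤s z≤n) (clique₁ (ℕ.m≤n⇒m≤1+n (At-< p)))
    j≢α : ∀ {k z} → At α k z → j ≢ z
    j≢α p = P′ (in-α p) at-v (s≤s (At-< p)) (clique₁ ℕ.≤-refl) ∘ sym
    α≢α : ∀ {k l y z} → At α k y → At α l z → k < l → y ≢ z
    α≢α p q k<l = P′ (in-α p) (in-α q) (s≤s k<l) (clique₁ (ℕ.m≤n⇒m≤1+n (At-< q)))
    i≢β : ∀ {k z} → At β k z → i ≢ z
    i≢β {k} p = P′ at-w (in-β p) (s≤s z≤n) (clique₂ (inj₁ refl) (ℕ.m<m+n (suc b) (s≤s z≤n)) (last p))
    β≢β : ∀ {k l y z} → At β k y → At β l z → k < l → y ≢ z
    β≢β p q k<l = P′ (in-β p) (in-β q) (ℕ.+-monoʳ-< (suc b) (s≤s k<l))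
      (clique₂ (inj₂ (ℕ.m<m+n (suc b) (s≤s z≤n))) (ℕ.m<m+n (suc b) (s≤s z≤n)) (last q))
    γ≢γ : ∀ {k y z} → At (j ∷ γ) k y → At γ k z → y ≢ z
    -- The predecessor of the first path vertex is v itself, joined to it by the hook; later
    -- neighbours are joined by links.
    γ≢γ here q = P′ at-v (in-γ q)
      (ℕ.<-≤-trans (ℕ.m<m+n (suc b) (s≤s z≤n)) (ℕ.m≤m+n (suc b + suc c) 0))
      (hook refl (ℕ.+-identityʳ _))
    γ≢γ {suc k} (there p) q = P′ (in-γ p) (in-γ q) (ℕ.+-monoʳ-< (suc b + suc c) (ℕ.n<1+n k))
      (link (ℕ.m≤m+n _ k) (ℕ.+-suc (suc b + suc c) k))

  admissible⇒Proper : T (admissible i α j β γ) → Proper (suc b) (suc c) κ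
  admissible⇒Proper t p q = P (position p) (position q)
    where
    t-differ : T (differ j i)
    t-differ = proj₁ (to T-∧ t)
    t-α : T (fresh i α ∧ fresh j α ∧ distinct α)
    t-α = proj₁ (to T-∧ (proj₂ (to (T-∧ {differ j i}) t)))
    t-βγ : T ((fresh i β ∧ distinct β) ∧ walk j γ)
    t-βγ = proj₂ (to (T-∧ {fresh i α ∧ fresh j α ∧ distinct α}) (proj₂ (to (T-∧ {differ j i}) t)))
    t-jα : T (fresh j α ∧ distinct α)
    t-jα = proj₂ (to (T-∧ {fresh i α}) t-α)
    t-β : T (fresh i β ∧ distinct β)
    t-β = proj₁ (to T-∧ t-βγ)
    α-< : ∀ {k z} → At α k z → suc k < suc b
    α-< p = s≤s (At-< p)
    β-> : ∀ {k} → suc b < suc b + suc k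
    β-> = ℕ.m<m+n (suc b) (s≤s z≤n)
    β-< : ∀ {k z} → At β k z → suc b + suc k < suc b + suc c
    β-< p = ℕ.+-monoʳ-< (suc b) (s≤s (At-< p))
    γ-≥ : ∀ {k} → suc b + suc c ≤ suc b + suc c + k
    γ-≥ {k} = ℕ.m≤m+n (suc b + suc c) k
    γ-> : ∀ {k} → suc b < suc b + suc c + k
    γ-> = ℕ.<-≤-trans β-> γ-≥

    -- The cliques meet in w alone, and w has number 0, so a vertex of the first clique with
    -- positive number has no neighbour in `β`.
    β-nonadjacent : ∀ {k l z} → 0 < k → k ≤ suc b → At β l z → ¬ Edge (suc b) (suc c) k (suc b + suc l)
    β-nonadjacent 0<k k≤b q (clique₁ l≤b)               = ℕ.<⇒≱ β-> l≤b
    β-nonadjacent 0<k k≤b q (clique₂ (inj₁ refl) _ _)   = ℕ.<-irrefl refl 0<k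
    β-nonadjacent 0<k k≤b q (clique₂ (inj₂ b<k) _ _)    = ℕ.<⇒≱ b<k k≤b
    β-nonadjacent 0<k k≤b q (hook _ l≡)                 = ℕ.<⇒≢ (β-< q) l≡
    β-nonadjacent 0<k k≤b q (link b+c≤k _)              = ℕ.<⇒≱ β-> (ℕ.≤-trans b+c≤k k≤b)
    γ-nonadjacent : ∀ {k l} → k < suc b + suc c → k ≢ suc b →
      ¬ Edge (suc b) (suc c) k (suc b + suc c + l)
    γ-nonadjacent k< k≢b (clique₁ l≤b)    = ℕ.<⇒≱ γ-> l≤b
    γ-nonadjacent k< k≢b (clique₂ _ _ l≤) = ℕ.<⇒≱ (s≤s l≤) γ-≥
    γ-nonadjacent k< k≢b (hook k≡b _)     = k≢b k≡b
    γ-nonadjacent k< k≢b (link b+c≤k _)   = ℕ.<⇒≱ k< b+c≤k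
    v-γ : ∀ {l z} → At γ l z → Edge (suc b) (suc c) (suc b) (suc b + suc c + l) → j ≢ z
    v-γ q (clique₁ l≤b)    = contradiction l≤b (ℕ.<⇒≱ γ->)
    v-γ q (clique₂ _ _ l≤) = contradiction γ-≥ (ℕ.<⇒≱ (s≤s l≤))
    -- A hook ends exactly at `suc b + suc c`, which forces `l` to be 0, the first path vertex.
    v-γ {l} q (hook _ l≡)
      rewrite ℕ.+-cancelˡ-≡ (suc b + suc c) l 0 (trans l≡ (sym (ℕ.+-identityʳ _)))
      = walk⇒≢ (proj₂ (to (T-∧ {fresh i β ∧ distinct β}) t-βγ)) here q
    v-γ q (link b+c≤b _)   = contradiction b+c≤b (ℕ.<⇒≱ β->)
    γ-γ : ∀ {k l y z} → At γ k y → At γ l z →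
      Edge (suc b) (suc c) (suc b + suc c + k) (suc b + suc c + l) → y ≢ z
    γ-γ p q (clique₁ l≤b)    = contradiction l≤b (ℕ.<⇒≱ γ->)
    γ-γ p q (clique₂ _ _ l≤) = contradiction γ-≥ (ℕ.<⇒≱ (s≤s l≤))
    γ-γ p q (hook k≡b _)     = contradiction k≡b (ℕ.>⇒≢ γ->)
    γ-γ {k} {l} p q (link _ l≡)
      rewrite ℕ.+-cancelˡ-≡ (suc b + suc c) l (suc k) (trans l≡ (sym (ℕ.+-suc _ k)))
      = walk⇒≢ (proj₂ (to (T-∧ {fresh i β ∧ distinct β}) t-βγ)) (there p) q

    -- Pairs inside one clique follow from the colour conditions whatever the edge is; pairs on the
    -- path or from v to the path need the edge to identify neighbours. The other increasing pairs
    -- are not adjacent, and the remaining ones violate `k < l`.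
    P : ∀ {k l y z} → Position k y → Position l z → k < l → Edge (suc b) (suc c) k l → y ≢ z
    P at-w     at-w     () _
    P at-w     (in-α q) k<l _ = fresh⇒≢ (proj₁ (to T-∧ t-α)) q
    P at-w     at-v     k<l _ = differ⇒≢ t-differ ∘ sym
    P at-w     (in-β q) k<l _ = fresh⇒≢ (proj₁ (to T-∧ t-β)) q
    P (in-α p) (in-α q) (s≤s k<l) _ = distinct⇒≢ (proj₂ (to (T-∧ {fresh j α}) t-jα)) p q k<l
    P (in-α p) at-v     k<l _ = fresh⇒≢ (proj₁ (to T-∧ t-jα)) p ∘ sym
    P (in-β p) (in-β q) k<l _ = distinct⇒≢ (proj₂ (to (T-∧ {fresh i β}) t-β)) p q
      (ℕ.≤-pred (ℕ.+-cancelˡ-< (suc b) _ _ k<l))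
    P at-v     (in-γ q) k<l ed = v-γ q ed
    P (in-γ p) (in-γ q) k<l ed = γ-γ p q ed
    P (in-α p) (in-β q) k<l ed = contradiction ed (β-nonadjacent (s≤s z≤n) (ℕ.<⇒≤ (α-< p)) q)
    P at-v     (in-β q) k<l ed = contradiction ed (β-nonadjacent (s≤s z≤n) ℕ.≤-refl q)
    P at-w     (in-γ q) k<l ed = contradiction ed (γ-nonadjacent (s≤s z≤n) (λ ()))
    P (in-α p) (in-γ q) k<l ed = contradiction ed
      (γ-nonadjacent (ℕ.<-trans (α-< p) (ℕ.m<m+n (suc b) (s≤s z≤n))) (ℕ.<⇒≢ (α-< p)))
    P (in-β p) (in-γ q) k<l ed = contradiction ed (γ-nonadjacent (β-< p) (ℕ.>⇒≢ β->))
    P (in-α p) at-w     () _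
    P at-v     at-w     () _
    P (in-β p) at-w     () _
    P (in-γ p) at-w     () _
    P at-v     at-v     k<l _ = contradiction k<l (ℕ.<-irrefl refl)
    P at-v     (in-α q) k<l _ = contradiction k<l (ℕ.<-asym (α-< q))
    P (in-β p) (in-α q) k<l _ = contradiction k<l (ℕ.<-asym (ℕ.<-trans (α-< q) β->))
    P (in-β p) at-v     k<l _ = contradiction k<l (ℕ.<-asym β->)
    P (in-γ p) (in-α q) k<l _ = contradiction k<l (ℕ.<-asym (ℕ.<-trans (α-< q) γ->))
    P (in-γ p) at-v     k<l _ = contradiction k<l (ℕ.<-asym γ->)
    P (in-γ p) (in-β q) k<l _ = contradiction k<l (ℕ.<-asym (ℕ.<-≤-trans (β-< q) γ-≥))

  proper≡admissible : proper (edgeGraph (suc b) (suc c) _) κ ≡ admissible i α j β γ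
  proper≡admissible = T-⇔⇒≡ (λ t → Proper⇒admissible (proper⇒Proper (suc b) (suc c) κ t))
    (λ t → Proper⇒proper (suc b) (suc c) κ (admissible⇒Proper t))

-- Sums over initial segments of ℕ

T⇒≡true : ∀ {p} → T p → p ≡ true
T⇒≡true {true} _ = refl

¬T⇒≡false : ∀ {p} → ¬ T p → p ≡ false
¬T⇒≡false {true}  ¬p = contradiction tt ¬p
¬T⇒≡false {false} _  = refl

opaque
  unfolding ∑
  ∑-upTo-suc : ∀ n f → ∑ (upTo (suc n)) f ≡ f 0 +ℤ ∑ (upTo n) (f ∘ suc)
  ∑-upTo-suc n f = cong (λ xs → f 0 +ℤ sumℤ xs)
    (trans (map-applyUpTo suc f n) (sym (map-applyUpTo id (f ∘ suc) n)))

∑-upTo-cong : ∀ n {f g : ℕ → ℤ} → (∀ k → k < n → f k ≡ g k) → ∑ (upTo n) f ≡ ∑ (upTo n) g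
∑-upTo-cong zero    eq = trans (∑-[] _) (sym (∑-[] _))
∑-upTo-cong (suc n) eq = trans (∑-upTo-suc n _) (trans
  (cong₂ _+ℤ_ (eq 0 (s≤s z≤n)) (∑-upTo-cong n (λ k k<n → eq (suc k) (s≤s k<n))))
  (sym (∑-upTo-suc n _)))

∑-upTo-+ : ∀ m n f → ∑ (upTo (m + n)) f ≡ ∑ (upTo m) f +ℤ ∑ (upTo n) (λ k → f (m + k))
∑-upTo-+ zero    n f = sym (trans (cong (_+ℤ ∑ (upTo n) f) (∑-[] f)) (ℤ.+-identityˡ _))
∑-upTo-+ (suc m) n f = begin
  ∑ (upTo (suc m + n)) f
    ≡⟨ ∑-upTo-suc (m + n) f ⟩
  f 0 +ℤ ∑ (upTo (m + n)) (f ∘ suc)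
    ≡⟨ cong (f 0 +ℤ_) (∑-upTo-+ m n (f ∘ suc)) ⟩
  f 0 +ℤ (∑ (upTo m) (f ∘ suc) +ℤ rest)
    ≡⟨ ℤ.+-assoc (f 0) _ rest ⟨
  f 0 +ℤ ∑ (upTo m) (f ∘ suc) +ℤ rest
    ≡⟨ cong (_+ℤ rest) (∑-upTo-suc m f) ⟨
  ∑ (upTo (suc m)) f +ℤ rest ∎
  where rest = ∑ (upTo n) (λ k → f (suc m + k))

∑-upTo-0 : ∀ n {f : ℕ → ℤ} → (∀ k → k < n → f k ≡ + 0) → ∑ (upTo n) f ≡ + 0
∑-upTo-0 n f≡0 = trans (∑-upTo-cong n f≡0) (∑-0 (upTo n))

∑-upTo-truncate : ∀ {m n} f → m ≤ n → (∀ k → m ≤ k → k < n → f k ≡ + 0) →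
  ∑ (upTo n) f ≡ ∑ (upTo m) f
∑-upTo-truncate {m} {n} f m≤n f≡0 = begin
  ∑ (upTo n) f
    ≡⟨ cong (λ n → ∑ (upTo n) f) (ℕ.m+[n∸m]≡n m≤n) ⟨
  ∑ (upTo (m + (n ∸ m))) f
    ≡⟨ ∑-upTo-+ m (n ∸ m) f ⟩
  ∑ (upTo m) f +ℤ ∑ (upTo (n ∸ m)) (λ k → f (m + k))
    ≡⟨ cong (∑ (upTo m) f +ℤ_) (∑-upTo-0 (n ∸ m) (λ k k< → f≡0 (m + k) (ℕ.m≤m+n m k)
         (subst (m + k <_) (ℕ.m+[n∸m]≡n m≤n) (ℕ.+-monoʳ-< m k<)))) ⟩
  ∑ (upTo m) f +ℤ + 0
    ≡⟨ ℤ.+-identityʳ _ ⟩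
  ∑ (upTo m) f ∎

-- The top of the lower block is paired with the bottom of the upper block; removing both leaves the
-- blocks for the next pair of parameters, with the same total.
∑-upTo-W : ∀ f p q →
  ∑ (upTo (suc p)) f +ℤ ∑ (upTo (suc p)) (λ k → f (suc q + k)) ≡ W (λ i j → f i +ℤ f j) p q
∑-upTo-W f zero    q = cong₂ _+ℤ_ (single f) (trans (single (λ k → f (suc q + k))) (cong f (ℕ.+-identityʳ (suc q))))
  where
  single : ∀ g → ∑ (upTo 1) g ≡ g 0
  single g = trans (∑-∷ 0 [] g) (trans (cong (g 0 +ℤ_) (∑-[] g)) (ℤ.+-identityʳ (g 0)))
∑-upTo-W f (suc p) q = begin
  ∑ (upTo (suc (suc p))) f +ℤ ∑ (upTo (suc (suc p))) (λ k → f (suc q + k))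
    ≡⟨ cong₂ _+ℤ_ last (trans (∑-upTo-suc (suc p) _) (cong₂ _+ℤ_ (cong f (ℕ.+-identityʳ (suc q)))
         (∑-upTo-cong (suc p) (λ k _ → cong f (ℕ.+-suc (suc q) k))))) ⟩
  ∑ (upTo (suc p)) f +ℤ f (suc p) +ℤ (f (suc q) +ℤ ∑ (upTo (suc p)) (λ k → f (suc (suc q) + k)))
    ≡⟨ lemma (∑ (upTo (suc p)) f) (f (suc p)) (f (suc q)) _ ⟩
  f (suc p) +ℤ f (suc q) +ℤ (∑ (upTo (suc p)) f +ℤ ∑ (upTo (suc p)) (λ k → f (suc (suc q) + k)))
    ≡⟨ cong (f (suc p) +ℤ f (suc q) +ℤ_) (∑-upTo-W f p (suc q)) ⟩
  W (λ i j → f i +ℤ f j) (suc p) q ∎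
  where
  lemma : ∀ a b c d → a +ℤ b +ℤ (c +ℤ d) ≡ b +ℤ c +ℤ (a +ℤ d)
  lemma = solve-∀
  last : ∑ (upTo (suc (suc p))) f ≡ ∑ (upTo (suc p)) f +ℤ f (suc p)
  last = begin
    ∑ (upTo (suc (suc p))) f
      ≡⟨ cong (λ n → ∑ (upTo n) f) (ℕ.+-comm 1 (suc p)) ⟩
    ∑ (upTo (suc p + 1)) f
      ≡⟨ ∑-upTo-+ (suc p) 1 f ⟩
    ∑ (upTo (suc p)) f +ℤ ∑ (upTo 1) (λ k → f (suc p + k))
      ≡⟨ cong (∑ (upTo (suc p)) f +ℤ_) (trans (∑-∷ 0 [] _) (trans (cong (f (suc p + 0) +ℤ_) (∑-[] _))
           (trans (ℤ.+-identityʳ _) (cong f (ℕ.+-identityʳ (suc p)))))) ⟩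
    ∑ (upTo (suc p)) f +ℤ f (suc p) ∎

-- The vanishing hypothesis corresponds to the gap in the last parts that the theorem admits.
∑-upTo-outer : ∀ f {p q} → p ≤ q → (∀ k → p < k → k ≤ q → f k ≡ + 0) →
  ∑ (upTo (suc (suc (p + q)))) f ≡ W (λ i j → f i +ℤ f j) p q
∑-upTo-outer f {p} {q} p≤q f≡0 = begin
  ∑ (upTo (suc (suc (p + q)))) f
    ≡⟨ cong (λ n → ∑ (upTo (suc n)) f) (ℕ.+-comm (suc p) q) ⟩
  ∑ (upTo (suc q + suc p)) f
    ≡⟨ ∑-upTo-+ (suc q) (suc p) f ⟩
  ∑ (upTo (suc q)) f +ℤ ∑ (upTo (suc p)) (λ k → f (suc q + k))
    ≡⟨ cong (_+ℤ ∑ (upTo (suc p)) (λ k → f (suc q + k)))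
         (∑-upTo-truncate f (s≤s p≤q) (λ k p<k k≤q → f≡0 k p<k (ℕ.≤-pred k≤q))) ⟩
  ∑ (upTo (suc p)) f +ℤ ∑ (upTo (suc p)) (λ k → f (suc q + k))
    ≡⟨ ∑-upTo-W f p q ⟩
  W (λ i j → f i +ℤ f j) p q ∎

-- Compositions

-- Vectors are generated from the front, whereas the coefficients are governed by the last parts.
∑-allVecs-∷ʳ : ∀ (xs : List X) m f →
  ∑ (allVecs xs (suc m)) f ≡ ∑ xs (λ y → ∑ (allVecs xs m) (λ v → f (v ∷ʳᵛ y)))
∑-allVecs-∷ʳ xs zero    f = trans (∑-allVecs-suc xs 0 f)
  (∑-cong xs (λ y → trans (∑-∷ [] [] _) (trans (cong (f (y ∷ []) +ℤ_) (trans (∑-[] _) (sym (∑-[] _)))) (sym (∑-∷ [] [] _)))))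
∑-allVecs-∷ʳ xs (suc m) f = begin
  ∑ (allVecs xs (suc (suc m))) f
    ≡⟨ ∑-allVecs-suc xs (suc m) f ⟩
  ∑ xs (λ z → ∑ (allVecs xs (suc m)) (λ v → f (z ∷ v)))
    ≡⟨ ∑-cong xs (λ z → ∑-allVecs-∷ʳ xs m (λ v → f (z ∷ v))) ⟩
  ∑ xs (λ z → ∑ xs (λ y → ∑ (allVecs xs m) (λ v → f (z ∷ (v ∷ʳᵛ y)))))
    ≡⟨ ∑-swap xs xs _ ⟩
  ∑ xs (λ y → ∑ xs (λ z → ∑ (allVecs xs m) (λ v → f (z ∷ (v ∷ʳᵛ y)))))
    ≡⟨ ∑-cong xs (λ y → ∑-allVecs-suc xs m (λ v → f (v ∷ʳᵛ y))) ⟨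
  ∑ xs (λ y → ∑ (allVecs xs (suc m)) (λ v → f (v ∷ʳᵛ y))) ∎

-- The bound `M` on the parts is independent of the total `n`, because removing a part lowers the
-- total but leaves the range of the other parts as it was.
byLength : (List ℕ → ℤ) → (M l n : ℕ) → ℤ
byLength φ M l n =
  ∑ (allVecs (map suc (upTo M)) l) (λ v → ⟦ sum (toList v) ≡ᵇ n ⟧ *ℤ φ (toList v))

byLength-zero : ∀ φ M n → byLength φ M 0 n ≡ ⟦ 0 ≡ᵇ n ⟧ *ℤ φ []
byLength-zero φ M n = trans (∑-∷ [] [] _) (trans (cong (⟦ 0 ≡ᵇ n ⟧ *ℤ φ [] +ℤ_) (∑-[] _)) (ℤ.+-identityʳ _))

byLength-suc : ∀ φ {M n} l → n ≤ M →
  byLength φ M (suc l) n ≡ ∑ (upTo n) (λ k → byLength (φ ∘ (_∷ʳ suc k)) M l (n ∸ suc k))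
byLength-suc φ {M} {n} l n≤M = begin
  byLength φ M (suc l) n
    ≡⟨ trans (∑-allVecs-∷ʳ (map suc (upTo M)) l _) (∑-map suc (upTo M) _) ⟩
  ∑ (upTo M) (λ k → ∑ vecs (λ v → ⟦ sum (toList (v ∷ʳᵛ suc k)) ≡ᵇ n ⟧ *ℤ φ (toList (v ∷ʳᵛ suc k))))
    ≡⟨ ∑-cong (upTo M) (λ k → ∑-cong vecs (λ v → snoc k v)) ⟩
  ∑ (upTo M) (λ k → ∑ vecs (λ v → ⟦ sum (toList v) + suc k ≡ᵇ n ⟧ *ℤ φ (toList v ∷ʳ suc k)))
    -- A last part `suc k` with `n ≤ k` exceeds the total; for the others `n ∸ suc k` is an exact
    -- difference.
    ≡⟨ ∑-upTo-truncate _ n≤M (λ k n≤k _ → trans (∑-cong vecs (λ v → large k n≤k (sum (toList v)) _)) (∑-0 vecs)) ⟩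
  ∑ (upTo n) (λ k → ∑ vecs (λ v → ⟦ sum (toList v) + suc k ≡ᵇ n ⟧ *ℤ φ (toList v ∷ʳ suc k)))
    ≡⟨ ∑-upTo-cong n (λ k k<n → ∑-cong vecs (λ v → cong (λ t → ⟦ t ⟧ *ℤ φ (toList v ∷ʳ suc k))
         (small k k<n (sum (toList v))))) ⟩
  ∑ (upTo n) (λ k → byLength (φ ∘ (_∷ʳ suc k)) M l (n ∸ suc k)) ∎
  where
  vecs = allVecs (map suc (upTo M)) l
  snoc : ∀ k (v : Vec ℕ l) → ⟦ sum (toList (v ∷ʳᵛ suc k)) ≡ᵇ n ⟧ *ℤ φ (toList (v ∷ʳᵛ suc k))
    ≡ ⟦ sum (toList v) + suc k ≡ᵇ n ⟧ *ℤ φ (toList v ∷ʳ suc k)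
  snoc k v rewrite toList-∷ʳ (suc k) v | sum-++ (toList v) [ suc k ] | ℕ.+-identityʳ k = refl
  large : ∀ k → n ≤ k → ∀ s t → ⟦ s + suc k ≡ᵇ n ⟧ *ℤ t ≡ + 0
  large k n≤k s t rewrite ¬T⇒≡false {s + suc k ≡ᵇ n}
    (λ eq → ℕ.<⇒≢ (ℕ.≤-trans (s≤s n≤k) (ℕ.m≤n+m (suc k) s)) (sym (ℕ.≡ᵇ⇒≡ _ n eq))) = refl
  small : ∀ k → k < n → ∀ s → (s + suc k ≡ᵇ n) ≡ (s ≡ᵇ n ∸ suc k)
  small k k<n s = T-⇔⇒≡
    (λ t → ℕ.≡⇒≡ᵇ s _ (trans (sym (ℕ.m+n∸n≡m s (suc k))) (cong (_∸ suc k) (ℕ.≡ᵇ⇒≡ (s + suc k) n t))))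
    (λ t → ℕ.≡⇒≡ᵇ _ n (trans (cong (λ t → t + suc k) (ℕ.≡ᵇ⇒≡ s _ t)) (ℕ.m∸n+n≡m k<n)))

byLength-bound : ∀ φ {M M′ n} l → n ≤ M → n ≤ M′ → byLength φ M l n ≡ byLength φ M′ l n
byLength-bound φ {M} {M′} {n} zero    n≤M n≤M′ = trans (byLength-zero φ M n) (sym (byLength-zero φ M′ n))
byLength-bound φ {M} {M′} {n} (suc l) n≤M n≤M′ = begin
  byLength φ M (suc l) n
    ≡⟨ byLength-suc φ l n≤M ⟩
  ∑ (upTo n) (λ k → byLength (φ ∘ (_∷ʳ suc k)) M l (n ∸ suc k))
    ≡⟨ ∑-cong (upTo n) (λ k → byLength-bound (φ ∘ (_∷ʳ suc k)) l (ℕ.≤-trans (ℕ.m∸n≤m n (suc k)) n≤M)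
                                                  (ℕ.≤-trans (ℕ.m∸n≤m n (suc k)) n≤M′)) ⟩
  ∑ (upTo n) (λ k → byLength (φ ∘ (_∷ʳ suc k)) M′ l (n ∸ suc k))
    ≡⟨ byLength-suc φ l n≤M′ ⟨
  byLength φ M′ (suc l) n ∎

byLength-long : ∀ φ {M n} l → n ≤ M → n < l → byLength φ M l n ≡ + 0
byLength-long φ {M} {n} (suc l) n≤M n<l = trans (byLength-suc φ l n≤M)
  (∑-upTo-0 n (λ k k<n → byLength-long (φ ∘ (_∷ʳ suc k)) l (ℕ.≤-trans (ℕ.m∸n≤m n (suc k)) n≤M)
    (ℕ.<-≤-trans (ℕ.∸-monoʳ-< (s≤s z≤n) k<n) (ℕ.≤-pred n<l))))

∑-compositions : ∀ n φ → ∑ (compositions n) φ ≡ ∑ (upTo (suc n)) (λ l → byLength φ n l n)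
∑-compositions n φ = trans (∑-filter (λ K → sum K ℕ.≟ n) _ φ)
  (trans (∑-concatMap _ (upTo (suc n)) _)
    (∑-cong (upTo (suc n)) (λ l → ∑-map toList (allVecs (map suc (upTo n)) l) _)))

∑-compositions-0 : ∀ φ → ∑ (compositions 0) φ ≡ φ []
∑-compositions-0 φ = trans (∑-∷ [] [] φ) (trans (cong (φ [] +ℤ_) (∑-[] φ)) (ℤ.+-identityʳ (φ [])))

-- After the last part is removed, length and parts are still bounded by `suc n`; `byLength-long`
-- and `byLength-bound` lower both bounds to `n ∸ k`.
∑-compositions-suc : ∀ n φ →
  ∑ (compositions (suc n)) φ ≡ ∑ (upTo (suc n)) (λ k → ∑ (compositions (n ∸ k)) (φ ∘ (_∷ʳ suc k)))
∑-compositions-suc n φ = begin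
  ∑ (compositions (suc n)) φ
    ≡⟨ trans (∑-compositions (suc n) φ) (∑-upTo-suc (suc n) _) ⟩
  byLength φ (suc n) 0 (suc n) +ℤ ∑ (upTo (suc n)) (λ l → byLength φ (suc n) (suc l) (suc n))
    ≡⟨ trans (cong (_+ℤ longer) (byLength-zero φ (suc n) (suc n))) (ℤ.+-identityˡ longer) ⟩
  ∑ (upTo (suc n)) (λ l → byLength φ (suc n) (suc l) (suc n))
    ≡⟨ ∑-cong (upTo (suc n)) (λ l → byLength-suc φ l ℕ.≤-refl) ⟩
  ∑ (upTo (suc n)) (λ l → ∑ (upTo (suc n)) (λ k → byLength (φ ∘ (_∷ʳ suc k)) (suc n) l (n ∸ k)))
    ≡⟨ ∑-swap (upTo (suc n)) (upTo (suc n)) _ ⟩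
  ∑ (upTo (suc n)) (λ k → ∑ (upTo (suc n)) (λ l → byLength (φ ∘ (_∷ʳ suc k)) (suc n) l (n ∸ k)))
    ≡⟨ ∑-cong (upTo (suc n)) (λ k → trans
         (∑-upTo-truncate _ (s≤s (ℕ.m∸n≤m n k)) (λ l n-k<l _ → byLength-long (φ ∘ (_∷ʳ suc k)) l (n-k≤ k) n-k<l))
         (trans (∑-cong (upTo (suc (n ∸ k))) (λ l → byLength-bound (φ ∘ (_∷ʳ suc k)) l (n-k≤ k) ℕ.≤-refl))
                (sym (∑-compositions (n ∸ k) (φ ∘ (_∷ʳ suc k)))))) ⟩
  ∑ (upTo (suc n)) (λ k → ∑ (compositions (n ∸ k)) (φ ∘ (_∷ʳ suc k))) ∎
  where
  longer = ∑ (upTo (suc n)) (λ l → byLength φ (suc n) (suc l) (suc n))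
  n-k≤ : ∀ k → n ∸ k ≤ suc n
  n-k≤ k = ℕ.m≤n⇒m≤1+n (ℕ.m∸n≤m n k)

-- A composition of a positive number is nonempty, so the default values of `wK` and `lastPart` at
-- `[]` never enter.
∑-compositions-cong : ∀ n {φ ψ : List ℕ → ℤ} → (∀ K k → φ (K ∷ʳ suc k) ≡ ψ (K ∷ʳ suc k)) →
  ∑ (compositions (suc n)) φ ≡ ∑ (compositions (suc n)) ψ
∑-compositions-cong n {φ} {ψ} eq = trans (∑-compositions-suc n φ)
  (trans (∑-cong (upTo (suc n)) (λ k → ∑-cong (compositions (n ∸ k)) (λ K → eq K k)))
         (sym (∑-compositions-suc n ψ)))

lastPart-∷ʳ : ∀ K k → lastPart (K ∷ʳ k) ≡ k
lastPart-∷ʳ K k rewrite reverse-++ K [ k ] = refl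

wK-∷-∷ʳ : ∀ k K l → wK (k ∷ K ∷ʳ l) ≡ (l ∸ 1) * wK (k ∷ K)
wK-∷-∷ʳ k K l = trans (cong (k *_) (fold K)) (begin
  k * ((l ∸ 1) * r)  ≡⟨ ℕ.*-assoc k (l ∸ 1) r ⟨
  k * (l ∸ 1) * r    ≡⟨ cong (_* r) (ℕ.*-comm k (l ∸ 1)) ⟩
  (l ∸ 1) * k * r    ≡⟨ ℕ.*-assoc (l ∸ 1) k r ⟩
  (l ∸ 1) * (k * r)  ∎)
  where
  r = foldr (λ j r → (j ∸ 1) * r) 1 K
  fold : ∀ K → foldr (λ j r → (j ∸ 1) * r) 1 (K ∷ʳ l) ≡ (l ∸ 1) * foldr (λ j r → (j ∸ 1) * r) 1 K
  fold []      = refl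
  fold (j ∷ K) = begin
    (j ∸ 1) * foldr (λ j r → (j ∸ 1) * r) 1 (K ∷ʳ l)  ≡⟨ cong ((j ∸ 1) *_) (fold K) ⟩
    (j ∸ 1) * ((l ∸ 1) * s)                            ≡⟨ ℕ.*-assoc (j ∸ 1) (l ∸ 1) s ⟨
    (j ∸ 1) * (l ∸ 1) * s                              ≡⟨ cong (_* s) (ℕ.*-comm (j ∸ 1) (l ∸ 1)) ⟩
    (l ∸ 1) * (j ∸ 1) * s                              ≡⟨ ℕ.*-assoc (l ∸ 1) (j ∸ 1) s ⟩
    (l ∸ 1) * ((j ∸ 1) * s)                            ∎
    where s = foldr (λ j r → (j ∸ 1) * r) 1 K

-- The first part enters `wK` undiminished, hence a new last part contributes one less than its size
-- only after a nonempty prefix.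
wK-∷ʳ-∷ʳ : ∀ K k l → wK (K ∷ʳ k ∷ʳ l) ≡ (l ∸ 1) * wK (K ∷ʳ k)
wK-∷ʳ-∷ʳ []       k l = wK-∷-∷ʳ k [] l
wK-∷ʳ-∷ʳ (k₁ ∷ K) k l = wK-∷-∷ʳ k₁ (K ∷ʳ k) l

elemK-∷ʳ : ∀ K k (x : Fin N → ℤ) → elemK (K ∷ʳ k) N x ≡ e k x *ℤ elemK K N x
elemK-∷ʳ []       k x = cong (_*ℤ + 1) (elem≡e k _ x)
elemK-∷ʳ {N} (k₁ ∷ K) k x = trans (cong (elem k₁ N x *ℤ_) (elemK-∷ʳ K k x)) (lemma (elem k₁ N x) (e k x) (elemK K N x))
  where
  lemma : ∀ a b c → a *ℤ (b *ℤ c) ≡ b *ℤ (a *ℤ c)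
  lemma = solve-∀

-- The contribution of the compositions with last part k + 1 and other parts summing to r.
byLastPart : (Fin N → ℤ) → ℕ → ℕ → ℤ
byLastPart x k zero    = e (suc k) x *ℤ + suc k
byLastPart x k (suc r) = e (suc k) x *ℤ (+ k *ℤ lollipop 0 r x)

-- Iterates `lollipop-suc` until the path is used up. After `t` trades the clique has m + t + 1
-- vertices, and this size becomes the last part of the composition.
lollipop-∑ : ∀ m a (x : Fin N → ℤ) →
  lollipop m a x ≡ ∑ (upTo (suc a)) (λ t → byLastPart x (m + t) (a ∸ t))
lollipop-∑ m zero x = begin
  lollipop m 0 x                    ≡⟨ lollipop-zero m x ⟩
  + suc m *ℤ e (suc m) x            ≡⟨ ℤ.*-comm (+ suc m) _ ⟩
  byLastPart x m 0                  ≡⟨ cong (λ m → byLastPart x m 0) (ℕ.+-identityʳ m) ⟨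
  byLastPart x (m + 0) 0            ≡⟨ ℤ.+-identityʳ _ ⟨
  byLastPart x (m + 0) 0 +ℤ + 0     ≡⟨ cong (byLastPart x (m + 0) 0 +ℤ_) (∑-[] _) ⟨
  byLastPart x (m + 0) 0 +ℤ ∑ [] (λ t → byLastPart x (m + t) (0 ∸ t))  ≡⟨ ∑-∷ 0 [] _ ⟨
  ∑ (upTo 1) (λ t → byLastPart x (m + t) (0 ∸ t)) ∎
lollipop-∑ m (suc a) x = begin
  lollipop m (suc a) x
    ≡⟨ lollipop-suc m a x ⟩
  + m *ℤ e (suc m) x *ℤ lollipop 0 a x +ℤ lollipop (suc m) a x
    ≡⟨ cong₂ _+ℤ_ (lemma (+ m) (e (suc m) x) (lollipop 0 a x)) (lollipop-∑ (suc m) a x) ⟩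
  byLastPart x m (suc a) +ℤ ∑ (upTo (suc a)) (λ t → byLastPart x (suc m + t) (a ∸ t))
    ≡⟨ cong₂ _+ℤ_ (cong (λ m → byLastPart x m (suc a)) (ℕ.+-identityʳ m))
         (∑-cong (upTo (suc a)) (λ t → cong (λ k → byLastPart x k (a ∸ t)) (ℕ.+-suc m t))) ⟨
  byLastPart x (m + 0) (suc a) +ℤ ∑ (upTo (suc a)) (λ t → byLastPart x (m + suc t) (a ∸ t))
    ≡⟨ ∑-upTo-suc (suc a) _ ⟨
  ∑ (upTo (suc (suc a))) (λ t → byLastPart x (m + t) (suc a ∸ t)) ∎
  where
  lemma : ∀ m r p → m *ℤ r *ℤ p ≡ r *ℤ (m *ℤ p)
  lemma = solve-∀

term : (Fin N → ℤ) → List ℕ → ℤ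
term {N} x K = + wK K *ℤ elemK K N x

lastAtLeast : (Fin N → ℤ) → ℕ → List ℕ → ℤ
lastAtLeast x s K = ⟦ s ≤ᵇ lastPart K ⟧ *ℤ term x K

-- Strong induction on `a`, for all `m` at once. If the last part is m + t + 1, the others sum to
-- `a ∸ t`; when there are any, they are summed by the hypothesis at `m = 0`, where the bound on the
-- last part is void. The result is the same recursion as in `lollipop-∑`.
∑-compositions-lollipop : ∀ (x : Fin N → ℤ) a m →
  ∑ (compositions (suc m + a)) (lastAtLeast x (suc m)) ≡ lollipop m a x
∑-compositions-lollipop {N} x = <-rec _ step
  where
  term-∷ʳ-∷ʳ : ∀ K l k → term x (K ∷ʳ suc l ∷ʳ suc k) ≡
    e (suc k) x *ℤ (+ k *ℤ lastAtLeast x 1 (K ∷ʳ suc l))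
  term-∷ʳ-∷ʳ K l k
    = trans (cong₂ (λ w s → + w *ℤ s) (wK-∷ʳ-∷ʳ K (suc l) (suc k)) (elemK-∷ʳ (K ∷ʳ suc l) (suc k) x))
      (trans (cong (_*ℤ (e (suc k) x *ℤ elemK (K ∷ʳ suc l) N x)) (ℤ.pos-* k (wK (K ∷ʳ suc l))))
      (trans (lemma (+ k) (+ wK (K ∷ʳ suc l)) (e (suc k) x) (elemK (K ∷ʳ suc l) N x))
        (cong (λ n → e (suc k) x *ℤ (+ k *ℤ (⟦ 1 ≤ᵇ n ⟧ *ℤ term x (K ∷ʳ suc l))))
          (sym (lastPart-∷ʳ K (suc l))))))
    where
    lemma : ∀ k w r s → k *ℤ w *ℤ (r *ℤ s) ≡ r *ℤ (k *ℤ (+ 1 *ℤ (w *ℤ s)))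
    lemma = solve-∀
  step : ∀ a → (∀ {r} → r < a → ∀ m →
      ∑ (compositions (suc m + r)) (lastAtLeast x (suc m)) ≡ lollipop m r x) →
    ∀ m → ∑ (compositions (suc m + a)) (lastAtLeast x (suc m)) ≡ lollipop m a x
  step a rec m = begin
    ∑ (compositions (suc m + a)) (lastAtLeast x (suc m))
      ≡⟨ ∑-compositions-suc (m + a) _ ⟩
    ∑ (upTo (suc (m + a))) f
      ≡⟨ cong (λ n → ∑ (upTo n) f) (ℕ.+-suc m a) ⟨
    ∑ (upTo (m + suc a)) f
      ≡⟨ ∑-upTo-+ m (suc a) f ⟩
    ∑ (upTo m) f +ℤ ∑ (upTo (suc a)) (λ t → f (m + t))
      ≡⟨ cong₂ _+ℤ_ (∑-upTo-0 m small) (∑-upTo-cong (suc a) (λ t t≤a → large t (ℕ.≤-pred t≤a))) ⟩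
    + 0 +ℤ ∑ (upTo (suc a)) (λ t → byLastPart x (m + t) (a ∸ t))
      ≡⟨ ℤ.+-identityˡ _ ⟩
    ∑ (upTo (suc a)) (λ t → byLastPart x (m + t) (a ∸ t))
      ≡⟨ lollipop-∑ m a x ⟨
    lollipop m a x ∎
    where
    f : ℕ → ℤ
    f k = ∑ (compositions (m + a ∸ k)) (λ K → lastAtLeast x (suc m) (K ∷ʳ suc k))
    small : ∀ k → k < m → f k ≡ + 0
    small k k<m = trans (∑-cong (compositions (m + a ∸ k)) vanish) (∑-0 (compositions (m + a ∸ k)))
      where
      vanish : ∀ K → lastAtLeast x (suc m) (K ∷ʳ suc k) ≡ + 0
      vanish K rewrite lastPart-∷ʳ K (suc k)
        | ¬T⇒≡false {suc m ≤ᵇ suc k} (λ t → ℕ.<⇒≱ (s≤s k<m) (ℕ.≤ᵇ⇒≤ (suc m) (suc k) t)) = refl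
    byLast : ∀ k r → r ≤ a → ∑ (compositions r) (λ K → term x (K ∷ʳ suc k)) ≡ byLastPart x k r
    byLast k zero    r≤a = trans (∑-compositions-0 _)
      (trans (cong (λ w → + w *ℤ elemK [ suc k ] N x) (ℕ.*-identityʳ (suc k)))
        (trans (cong (λ t → + suc k *ℤ (t *ℤ + 1)) (elem≡e (suc k) N x)) (lemma (+ suc k) (e (suc k) x))))
      where
      lemma : ∀ k r → k *ℤ (r *ℤ + 1) ≡ r *ℤ k
      lemma = solve-∀
    byLast k (suc r) r<a = begin
      ∑ (compositions (suc r)) (λ K → term x (K ∷ʳ suc k))
        ≡⟨ ∑-compositions-cong r (λ K l → term-∷ʳ-∷ʳ K l k) ⟩
      ∑ (compositions (suc r)) (λ K → e (suc k) x *ℤ (+ k *ℤ lastAtLeast x 1 K))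
        ≡⟨ trans (∑-*ˡ (compositions (suc r)) (e (suc k) x) _)
             (cong (e (suc k) x *ℤ_) (trans (∑-*ˡ (compositions (suc r)) (+ k) _)
               (cong (+ k *ℤ_) (rec r<a 0)))) ⟩
      byLastPart x k (suc r) ∎
    large : ∀ t → t ≤ a → f (m + t) ≡ byLastPart x (m + t) (a ∸ t)
    large t t≤a = begin
      f (m + t)
        ≡⟨ cong (λ r → ∑ (compositions r) (λ K → lastAtLeast x (suc m) (K ∷ʳ suc (m + t))))
             (ℕ.[m+n]∸[m+o]≡n∸o m a t) ⟩
      ∑ (compositions (a ∸ t)) (λ K → lastAtLeast x (suc m) (K ∷ʳ suc (m + t)))
        ≡⟨ ∑-cong (compositions (a ∸ t)) keep ⟩
      ∑ (compositions (a ∸ t)) (λ K → term x (K ∷ʳ suc (m + t)))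
        ≡⟨ byLast (m + t) (a ∸ t) (ℕ.m∸n≤m a t) ⟩
      byLastPart x (m + t) (a ∸ t) ∎
      where
      keep : ∀ K → lastAtLeast x (suc m) (K ∷ʳ suc (m + t)) ≡ term x (K ∷ʳ suc (m + t))
      keep K rewrite lastPart-∷ʳ K (suc (m + t))
        | T⇒≡true {suc m ≤ᵇ suc (m + t)} (ℕ.≤⇒≤ᵇ (s≤s (ℕ.m≤m+n m t))) = ℤ.*-identityˡ _

-- The coefficients of the theorem, with b and c standing for b - 1 and c - 1

pos-∸ : ∀ {m n} → n ≤ m → + (m ∸ n) ≡ + m -ℤ + n
pos-∸ {m} {n} n≤m = trans (sym (ℤ.⊖-≥ n≤m)) (sym (ℤ.m-n≡m⊖n m n))

allowed : ℕ → ℕ → ℕ → Bool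
allowed b c k = (k ≤ᵇ b ⊓ c) ∨ (suc (suc b) ⊔ suc c ≤ᵇ k)

module _ (b c : ℕ) where

  allowed-≤ : ∀ {k} → k ≤ b ⊓ c → allowed b c k ≡ true
  allowed-≤ {k} k≤ = T⇒≡true (from T-∨ (inj₁ (ℕ.≤⇒≤ᵇ k≤)))

  allowed-≥ : ∀ {k} → suc (suc b) ⊔ suc c ≤ k → allowed b c k ≡ true
  allowed-≥ {k} ≤k = T⇒≡true (from (T-∨ {k ≤ᵇ b ⊓ c}) (inj₂ (ℕ.≤⇒≤ᵇ ≤k)))

  allowed-middle : ∀ {k} → b ⊓ c < k → k ≤ b ⊔ c → allowed b c k ≡ false
  allowed-middle {k} <k k≤ = ¬T⇒≡false (absurd ∘ to T-∨)
    where
    absurd : ¬ (T (k ≤ᵇ b ⊓ c) ⊎ T (suc (suc b) ⊔ suc c ≤ᵇ k))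
    absurd (inj₁ t) = ℕ.<⇒≱ <k (ℕ.≤ᵇ⇒≤ k _ t)
    absurd (inj₂ t) = ℕ.<⇒≱ (ℕ.<-≤-trans (s≤s k≤)
      (ℕ.⊔-mono-≤ (ℕ.n≤1+n (suc b)) (ℕ.≤-refl {suc c}))) (ℕ.≤ᵇ⇒≤ _ k t)

  -- At k ≡ suc b the two bounds on k disagree, but then the coefficient vanishes.
  ∣-∣-≤ : ∀ {k} → k ≤ b ⊓ c → ⟦ allowed b c k ⟧ *ℤ + ∣ suc b - k ∣ ≡ + suc b -ℤ + k
  ∣-∣-≤ {k} k≤ rewrite allowed-≤ k≤ = begin
    + 1 *ℤ + ∣ suc b - k ∣  ≡⟨ ℤ.*-identityˡ _ ⟩
    + ∣ suc b - k ∣         ≡⟨ cong +_ (ℕ.m≤n⇒∣n-m∣≡n∸m k≤b) ⟩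
    + (suc b ∸ k)           ≡⟨ pos-∸ k≤b ⟩
    + suc b -ℤ + k          ∎
    where
    k≤b : k ≤ suc b
    k≤b = ℕ.≤-trans k≤ (ℕ.≤-trans (ℕ.m⊓n≤m b c) (ℕ.n≤1+n b))

  ∣-∣-≥ : ∀ {k} → suc (b ⊔ c) ≤ k → ⟦ allowed b c k ⟧ *ℤ + ∣ suc b - k ∣ ≡ + k -ℤ + suc b
  ∣-∣-≥ {k} ≤k with k ℕ.≟ suc b
  ... | yes refl rewrite ℕ.∣n-n∣≡0 b | ℤ.+-inverseʳ (+ suc b) = ℤ.*-zeroʳ ⟦ allowed b c (suc b) ⟧
  ... | no  k≢b
    rewrite allowed-≥ {k} (ℕ.⊔-lub (ℕ.≤∧≢⇒< (ℕ.≤-trans (s≤s (ℕ.m≤m⊔n b c)) ≤k) (k≢b ∘ sym))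
                                   (ℕ.≤-trans (s≤s (ℕ.m≤n⊔m b c)) ≤k)) = begin
    + 1 *ℤ + ∣ suc b - k ∣  ≡⟨ ℤ.*-identityˡ _ ⟩
    + ∣ suc b - k ∣         ≡⟨ cong +_ (ℕ.m≤n⇒∣m-n∣≡n∸m b≤k) ⟩
    + (k ∸ suc b)           ≡⟨ pos-∸ b≤k ⟩
    + k -ℤ + suc b          ∎
    where
    b≤k : suc b ≤ k
    b≤k = ℕ.≤-trans (s≤s (ℕ.m≤m⊔n b c)) ≤k

  coeff₂-∷ʳ-∷ʳ : ∀ K l k → coeff₂ (suc b) (suc c) (K ∷ʳ l ∷ʳ k) ≡
    (if (k <ᵇ suc b + suc c) ∧ (suc b + suc c ≤ᵇ k + l) ∧ allowed b c k
     then ∣ suc b - k ∣ * wK (K ∷ʳ l) else 0)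
  coeff₂-∷ʳ-∷ʳ K l k
    rewrite reverse-++ (K ∷ʳ l) [ k ] | reverse-++ K [ l ]
          -- The weight in `coeff₂` is taken at the reversal of a reversed prefix, which has to be
          -- turned back into `K ∷ʳ l`.
          | trans (cong reverse (sym (reverse-++ K [ l ]))) (reverse-involutive (K ∷ʳ l)) = refl

  -- The guard in `coeff₂` leaves the compositions whose last part is at least b + c to `coeff₁`.
  coeff₂-long : ∀ K {k} → suc b + suc c ≤ k → coeff₂ (suc b) (suc c) (K ∷ʳ k) ≡ 0
  coeff₂-long K {k} b+c≤k with initLast K
  ... | []       = refl
  ... | K ∷ʳ′ l rewrite coeff₂-∷ʳ-∷ʳ K l k
    | ¬T⇒≡false {k <ᵇ suc b + suc c} (λ t → ℕ.<⇒≱ (ℕ.<ᵇ⇒< k _ t) b+c≤k) = refl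

-- The two sums of the theorem in terms of lollipops

module _ (b c a : ℕ) (x : Fin N → ℤ) where

  -- For positive `k` this collects the compositions with last part `k`: the lollipop sums the other
  -- parts, the last of which is at least b + c - k. For `k = 0` the factor `e 0 x` is 1 and the
  -- bound falls on the last part itself, as in `coeff₁`.
  summand : ℕ → ℤ
  summand k = ⟦ allowed b c k ⟧ *ℤ + ∣ suc b - k ∣ *ℤ (e k x *ℤ lollipop (suc (b + c) ∸ k) a x)

  b+c-suc : suc b + suc c ≡ suc (suc (b + c))
  b+c-suc = cong suc (ℕ.+-suc b c)

  ∑-coeff₁ : ∑ (compositions (suc (suc (b + c)) + a)) (λ K → + coeff₁ (suc b) (suc c) K *ℤ elemK K N x)
    ≡ summand 0
  ∑-coeff₁ = begin
    ∑ comps (λ K → + coeff₁ (suc b) (suc c) K *ℤ elemK K N x)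
      ≡⟨ ∑-cong comps unfold ⟩
    ∑ comps (λ K → + suc b *ℤ lastAtLeast x (suc (suc (b + c))) K)
      ≡⟨ trans (∑-*ˡ comps (+ suc b) _) (cong (+ suc b *ℤ_) (∑-compositions-lollipop x a (suc (b + c)))) ⟩
    + suc b *ℤ lollipop (suc (b + c)) a x
      ≡⟨ lemma (+ suc b) (lollipop (suc (b + c)) a x) ⟩
    summand 0 ∎
    where
    comps = compositions (suc (suc (b + c)) + a)
    lemma : ∀ r s → r *ℤ s ≡ + 1 *ℤ r *ℤ (+ 1 *ℤ s)
    lemma = solve-∀
    unfold : ∀ K → + coeff₁ (suc b) (suc c) K *ℤ elemK K N x ≡ + suc b *ℤ lastAtLeast x (suc (suc (b + c))) K
    unfold K = trans
      (cong (λ s → + (if s ≤ᵇ lastPart K then suc b * wK K else 0) *ℤ elemK K N x) b+c-suc)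
      (split (suc (suc (b + c)) ≤ᵇ lastPart K))
      where
      assoc : ∀ r s t → r *ℤ s *ℤ t ≡ r *ℤ (+ 1 *ℤ (s *ℤ t))
      assoc = solve-∀
      split : ∀ p → + (if p then suc b * wK K else 0) *ℤ elemK K N x ≡ + suc b *ℤ (⟦ p ⟧ *ℤ term x K)
      split false = sym (ℤ.*-zeroʳ (+ suc b))
      split true  = trans (cong (_*ℤ elemK K N x) (ℤ.pos-* (suc b) (wK K)))
                      (assoc (+ suc b) (+ wK K) (elemK K N x))

  ∑-coeff₂ : ∑ (compositions (suc (suc (b + c)) + a)) (λ K → + coeff₂ (suc b) (suc c) K *ℤ elemK K N x)
    ≡ ∑ (upTo (suc (b + c))) (λ k → summand (suc k))
  ∑-coeff₂ = begin
    ∑ (compositions (suc (suc (b + c)) + a)) (λ K → + coeff₂ (suc b) (suc c) K *ℤ elemK K N x)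
      ≡⟨ ∑-compositions-suc (suc (b + c) + a) _ ⟩
    ∑ (upTo (suc (suc (b + c) + a))) f
      ≡⟨ ∑-upTo-truncate f (s≤s (ℕ.≤-trans (ℕ.m≤m+n (b + c) a) (ℕ.n≤1+n _))) (λ k b+c<k _ → large k b+c<k) ⟩
    ∑ (upTo (suc (b + c))) f
      ≡⟨ ∑-upTo-cong (suc (b + c)) (λ k k< → small k (ℕ.≤-pred k<)) ⟩
    ∑ (upTo (suc (b + c))) (λ k → summand (suc k)) ∎
    where
    g : List ℕ → ℤ
    g K = + coeff₂ (suc b) (suc c) K *ℤ elemK K N x
    f : ℕ → ℤ
    f k = ∑ (compositions (suc (b + c) + a ∸ k)) (λ K → g (K ∷ʳ suc k))
    large : ∀ k → suc (b + c) ≤ k → f k ≡ + 0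
    large k b+c<k = trans (∑-cong (compositions (suc (b + c) + a ∸ k)) vanish) (∑-0 (compositions (suc (b + c) + a ∸ k)))
      where
      vanish : ∀ K → g (K ∷ʳ suc k) ≡ + 0
      vanish K rewrite coeff₂-long b c K {suc k} (ℕ.≤-trans (ℕ.≤-reflexive b+c-suc) (s≤s b+c<k)) = refl
    small : ∀ k → k ≤ b + c → f k ≡ summand (suc k)
    small k k≤ = begin
      f k
        ≡⟨ cong (λ r → ∑ (compositions r) (λ K → g (K ∷ʳ suc k)))
             (trans (ℕ.+-∸-comm a (ℕ.m≤n⇒m≤1+n k≤)) (cong (λ t → t + a) (ℕ.+-∸-assoc 1 k≤))) ⟩
      ∑ comps (λ K → g (K ∷ʳ suc k))
        ≡⟨ ∑-compositions-cong (b + c ∸ k + a) split ⟩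
      ∑ comps (λ K → d *ℤ (e (suc k) x *ℤ lastAtLeast x (suc (b + c ∸ k)) K))
        ≡⟨ trans (∑-*ˡ comps d _) (cong (d *ℤ_) (trans (∑-*ˡ comps (e (suc k) x) _)
             (cong (e (suc k) x *ℤ_) (∑-compositions-lollipop x a (b + c ∸ k))))) ⟩
      summand (suc k) ∎
      where
      d = ⟦ allowed b c (suc k) ⟧ *ℤ + ∣ suc b - suc k ∣
      comps = compositions (suc (b + c ∸ k) + a)
      in-range : T (suc k <ᵇ suc b + suc c)
      in-range = ℕ.<⇒<ᵇ (ℕ.<-≤-trans (s≤s (s≤s k≤)) (ℕ.≤-reflexive (sym b+c-suc)))
      shift : ∀ l → (suc b + suc c ≤ᵇ suc k + suc l) ≡ (suc (b + c ∸ k) ≤ᵇ suc l)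
      shift l = T-⇔⇒≡
        (λ t → ℕ.≤⇒≤ᵇ (s≤s (ℕ.m≤n+o⇒m∸n≤o (b + c) k
          (ℕ.≤-pred (ℕ.≤-pred (ℕ.≤-trans (ℕ.≤-reflexive (sym b+c-suc))
            (ℕ.≤-trans (ℕ.≤ᵇ⇒≤ (suc b + suc c) _ t) (ℕ.≤-reflexive (cong suc (ℕ.+-suc k l))))))))))
        (λ t → ℕ.≤⇒≤ᵇ (ℕ.≤-trans (ℕ.≤-reflexive b+c-suc)
          (ℕ.≤-trans (s≤s (s≤s (ℕ.≤-trans (ℕ.m≤n+m∸n (b + c) k) (ℕ.+-monoʳ-≤ k (ℕ.≤-pred (ℕ.≤ᵇ⇒≤ (suc (b + c ∸ k)) _ t))))))
            (ℕ.≤-reflexive (sym (cong suc (ℕ.+-suc k l)))))))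
      split : ∀ K l → g (K ∷ʳ suc l ∷ʳ suc k) ≡ d *ℤ (e (suc k) x *ℤ lastAtLeast x (suc (b + c ∸ k)) (K ∷ʳ suc l))
      split K l = begin
        g (K ∷ʳ suc l ∷ʳ suc k)
          ≡⟨ cong₂ (λ n t → + n *ℤ t) (coeff₂-∷ʳ-∷ʳ b c K (suc l) (suc k)) (elemK-∷ʳ (K ∷ʳ suc l) (suc k) x) ⟩
        + (if (suc k <ᵇ suc b + suc c) ∧ (suc b + suc c ≤ᵇ suc k + suc l) ∧ allowed b c (suc k)
           then ∣ suc b - suc k ∣ * w else 0) *ℤ (e (suc k) x *ℤ s)
          ≡⟨ cong₂ (λ p q → + (if p ∧ q ∧ allowed b c (suc k) then ∣ suc b - suc k ∣ * w else 0) *ℤ (e (suc k) x *ℤ s))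
               (T⇒≡true in-range) (shift l) ⟩
        + (if (suc (b + c ∸ k) ≤ᵇ suc l) ∧ allowed b c (suc k)
           then ∣ suc b - suc k ∣ * w else 0) *ℤ (e (suc k) x *ℤ s)
          ≡⟨ pull (suc (b + c ∸ k) ≤ᵇ suc l) (allowed b c (suc k)) ∣ suc b - suc k ∣ w (e (suc k) x) s ⟩
        d *ℤ (e (suc k) x *ℤ (⟦ suc (b + c ∸ k) ≤ᵇ suc l ⟧ *ℤ term x (K ∷ʳ suc l)))
          ≡⟨ cong (λ n → d *ℤ (e (suc k) x *ℤ (⟦ suc (b + c ∸ k) ≤ᵇ n ⟧ *ℤ term x (K ∷ʳ suc l))))
               (lastPart-∷ʳ K (suc l)) ⟨
        d *ℤ (e (suc k) x *ℤ lastAtLeast x (suc (b + c ∸ k)) (K ∷ʳ suc l)) ∎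
        where
        w = wK (K ∷ʳ suc l)
        s = elemK (K ∷ʳ suc l) N x
        pull : ∀ p q d w r s → + (if p ∧ q then d * w else 0) *ℤ (r *ℤ s) ≡
          ⟦ q ⟧ *ℤ + d *ℤ (r *ℤ (⟦ p ⟧ *ℤ (+ w *ℤ s)))
        pull false q     d w r s = sym (trans (cong (⟦ q ⟧ *ℤ + d *ℤ_) (ℤ.*-zeroʳ r)) (ℤ.*-zeroʳ (⟦ q ⟧ *ℤ + d)))
        pull true  false d w r s = refl
        pull true  true  d w r s = trans (cong (_*ℤ (r *ℤ s)) (ℤ.pos-* d w)) (lemma (+ d) (+ w) r s)
          where
          lemma : ∀ d w r s → d *ℤ w *ℤ (r *ℤ s) ≡ + 1 *ℤ d *ℤ (r *ℤ (+ 1 *ℤ (w *ℤ s)))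
          lemma = solve-∀

  -- The indices that are not allowed lie between `b ⊓ c` and `b ⊔ c`. The others fold into pairs
  -- with sum `suc (b + c)`, and each pair is one `exchange` summed over `j` against the path.
  ∑-summand : ∑ (upTo (suc (suc (b + c)))) summand ≡
    ∑ (allFin N) (λ j → x j *ℤ (cliques x j b c *ℤ pathGF a x j))
  ∑-summand = begin
    ∑ (upTo (suc (suc (b + c)))) summand
      ≡⟨ cong (λ n → ∑ (upTo (suc (suc n))) summand) p+q ⟨
    ∑ (upTo (suc (suc (p + q)))) summand
      ≡⟨ ∑-upTo-outer summand (ℕ.≤-trans (ℕ.m⊓n≤m b c) (ℕ.m≤m⊔n b c)) (λ k p<k k≤q →
           cong (λ t → ⟦ t ⟧ *ℤ + ∣ suc b - k ∣ *ℤ (e k x *ℤ lollipop (suc (b + c) ∸ k) a x))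
             (allowed-middle b c p<k k≤q)) ⟩
    W (λ k l → summand k +ℤ summand l) p q
      ≡⟨ W-cong p q pair ⟩
    W (λ k l → ∑ (allFin N) (λ j → x j *ℤ pathGF a x j *ℤ exchange b x j k l)) p q
      ≡⟨ ∑-W (allFin N) (λ j k l → x j *ℤ pathGF a x j *ℤ exchange b x j k l) p q ⟨
    ∑ (allFin N) (λ j → W (λ k l → x j *ℤ pathGF a x j *ℤ exchange b x j k l) p q)
      ≡⟨ ∑-cong (allFin N) (λ j → trans (W-*ˡ (x j *ℤ pathGF a x j) (exchange b x j) p q)
           (trans (cong (x j *ℤ pathGF a x j *ℤ_) (sym (cliques≡W j)))
                  (reorder (x j) (pathGF a x j) (cliques x j b c)))) ⟩
    ∑ (allFin N) (λ j → x j *ℤ (cliques x j b c *ℤ pathGF a x j)) ∎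
    where
    p = b ⊓ c
    q = b ⊔ c
    reorder : ∀ r s t → r *ℤ s *ℤ t ≡ r *ℤ (t *ℤ s)
    reorder = solve-∀
    p+q : p + q ≡ b + c
    p+q with ℕ.≤-total b c
    ... | inj₁ b≤c rewrite ℕ.m≤n⇒m⊓n≡m b≤c | ℕ.m≤n⇒m⊔n≡n b≤c = refl
    ... | inj₂ c≤b rewrite ℕ.m≥n⇒m⊓n≡n c≤b | ℕ.m≥n⇒m⊔n≡m c≤b = ℕ.+-comm c b
    cliques≡W : ∀ j → cliques x j b c ≡ W (exchange b x j) p q
    cliques≡W j with ℕ.≤-total b c
    ... | inj₁ b≤c rewrite ℕ.m≤n⇒m⊓n≡m b≤c | ℕ.m≤n⇒m⊔n≡n b≤c = cliques≡W-≤ x j b c b≤c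
    ... | inj₂ c≤b rewrite ℕ.m≥n⇒m⊓n≡n c≤b | ℕ.m≥n⇒m⊔n≡m c≤b = cliques≡W-≥ x j b c
    -- The indices are complementary: `suc (b + c) ∸ k` is `l`, so `e k x` meets the lollipop of
    -- index `l`, and conversely.
    pair : ∀ k l → k ≤ p → suc q ≤ l → k + l ≡ suc (p + q) → summand k +ℤ summand l ≡
      ∑ (allFin N) (λ j → x j *ℤ pathGF a x j *ℤ exchange b x j k l)
    pair k l k≤p q<l k+l = begin
      summand k +ℤ summand l
        ≡⟨ cong₂ _+ℤ_
             (cong₂ (λ s t → s *ℤ (e k x *ℤ lollipop t a x)) (∣-∣-≤ b c k≤p)
                (trans (cong (_∸ k) (sym k+l′)) (ℕ.m+n∸m≡n k l)))
             (cong₂ (λ s t → s *ℤ (e l x *ℤ lollipop t a x)) (∣-∣-≥ b c q<l)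
                (trans (cong (_∸ l) (sym k+l′)) (ℕ.m+n∸n≡m k l))) ⟩
      s *ℤ (e k x *ℤ lollipop l a x) +ℤ t *ℤ (e l x *ℤ lollipop k a x)
        ≡⟨ cong₂ _+ℤ_ (trans (sym (ℤ.*-assoc s (e k x) _)) (sym (∑-*ˡ (allFin N) (s *ℤ e k x) _)))
                      (trans (sym (ℤ.*-assoc t (e l x) _)) (sym (∑-*ˡ (allFin N) (t *ℤ e l x) _))) ⟩
      ∑ (allFin N) (λ j → s *ℤ e k x *ℤ (x j *ℤ (e l (x ∖ j) *ℤ pathGF a x j)))
        +ℤ ∑ (allFin N) (λ j → t *ℤ e l x *ℤ (x j *ℤ (e k (x ∖ j) *ℤ pathGF a x j)))
        ≡⟨ ∑-+ (allFin N) _ _ ⟨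
      ∑ (allFin N) (λ j → s *ℤ e k x *ℤ (x j *ℤ (e l (x ∖ j) *ℤ pathGF a x j))
        +ℤ t *ℤ e l x *ℤ (x j *ℤ (e k (x ∖ j) *ℤ pathGF a x j)))
        ≡⟨ ∑-cong (allFin N) (λ j →
             lemma s t (e k x) (e l x) (e k (x ∖ j)) (e l (x ∖ j)) (x j) (pathGF a x j)) ⟩
      ∑ (allFin N) (λ j → x j *ℤ pathGF a x j *ℤ exchange b x j k l) ∎
      where
      s = + suc b -ℤ + k
      t = + l -ℤ + suc b
      k+l′ : k + l ≡ suc (b + c)
      k+l′ = trans k+l (cong suc p+q)
      lemma : ∀ s t ek el ak al z f →
        s *ℤ ek *ℤ (z *ℤ (al *ℤ f)) +ℤ t *ℤ el *ℤ (z *ℤ (ak *ℤ f)) ≡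
        z *ℤ f *ℤ (s *ℤ (ek *ℤ al) +ℤ t *ℤ (el *ℤ ak))
      lemma = solve-∀

-- The chromatic function of the graph and the final identity

prod-lookup : ∀ (x : Fin N → ℤ) (κ : Vec (Fin N) m) →
  prodℤ (map (λ v → x (lookup κ v)) (allFin m)) ≡ weight x κ
prod-lookup x []      = refl
prod-lookup x (z ∷ κ) = trans (prod-allFin-suc _ (λ v → x (lookup (z ∷ κ) v)))
  (cong (x z *ℤ_) (prod-lookup x κ))

chromX-∑ : ∀ (G : Graph m) (x : Fin N → ℤ) →
  chromX G N x ≡ ∑ (colourings N m) (λ κ → ⟦ proper G κ ⟧ *ℤ weight x κ)
chromX-∑ {m} {N} G x = trans (∑-def (colourings N m) _) (∑-cong (colourings N m) (λ κ →
  trans (if≡⟦⟧* (proper G κ) _) (cong (⟦ proper G κ ⟧ *ℤ_) (prod-lookup x κ))))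

chromX-edgeGraph : ∀ a b c (x : Fin N → ℤ) →
  chromX (edgeGraph (suc b) (suc c) (suc (b + suc (c + a)))) N x ≡
    + (b ! * c !) *ℤ ∑ (allFin N) (λ j → x j *ℤ (cliques x j b c *ℤ pathGF a x j))
chromX-edgeGraph a b c x = trans (chromX-∑ (edgeGraph (suc b) (suc c) _) x)
  (∑-admissible a b c x (proper (edgeGraph (suc b) (suc c) _)) proper≡admissible)

theorem5p4 : (a b c : ℕ) → 1 ≤ b → 1 ≤ c → (N : ℕ) → (x : Fin N → ℤ) →
    chromX (G5p4 a b c) N x
    ≡ (+ (((b ∸ 1) !) * ((c ∸ 1) !)))
    *ℤ ( sumℤ (map (λ K → (+ coeff₁ b c K) *ℤ elemK K N x) (compositions (a + b + c)))
    +ℤ sumℤ (map (λ K → (+ coeff₂ b c K) *ℤ elemK K N x) (compositions (a + b + c))) )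
theorem5p4 a (suc b) (suc c) _ _ N x = begin
  chromX (edgeGraph (suc b) (suc c) (a + suc b + suc c)) N x
    ≡⟨ cong (λ n → chromX (edgeGraph (suc b) (suc c) n) N x)
         (trans size (cong suc (sym (trans (ℕ.+-suc b (c + a)) (cong suc (sym (ℕ.+-assoc b c a))))))) ⟩
  chromX (edgeGraph (suc b) (suc c) (suc (b + suc (c + a)))) N x
    ≡⟨ chromX-edgeGraph a b c x ⟩
  + (b ! * c !) *ℤ ∑ (allFin N) (λ j → x j *ℤ (cliques x j b c *ℤ pathGF a x j))
    ≡⟨ cong (+ (b ! * c !) *ℤ_) (∑-summand b c a x) ⟨
  + (b ! * c !) *ℤ ∑ (upTo (suc (suc (b + c)))) (summand b c a x)
    ≡⟨ cong (+ (b ! * c !) *ℤ_) (trans (∑-upTo-suc (suc (b + c)) _)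
         (cong₂ _+ℤ_ (sym (∑-coeff₁ b c a x)) (sym (∑-coeff₂ b c a x)))) ⟩
  + (b ! * c !) *ℤ (∑ (compositions n) f₁ +ℤ ∑ (compositions n) f₂)
    ≡⟨ cong (λ n → + (b ! * c !) *ℤ (∑ (compositions n) f₁ +ℤ ∑ (compositions n) f₂)) size ⟨
  + (b ! * c !) *ℤ (∑ (compositions (a + suc b + suc c)) f₁ +ℤ ∑ (compositions (a + suc b + suc c)) f₂)
    ≡⟨ cong (+ (b ! * c !) *ℤ_) (cong₂ _+ℤ_ (∑-def (compositions (a + suc b + suc c)) f₁)
         (∑-def (compositions (a + suc b + suc c)) f₂)) ⟨
  + (b ! * c !) *ℤ (sumℤ (map f₁ (compositions (a + suc b + suc c)))
    +ℤ sumℤ (map f₂ (compositions (a + suc b + suc c)))) ∎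
  where
  n = suc (suc (b + c)) + a
  f₁ f₂ : List ℕ → ℤ
  f₁ K = + coeff₁ (suc b) (suc c) K *ℤ elemK K N x
  f₂ K = + coeff₂ (suc b) (suc c) K *ℤ elemK K N x
  size : a + suc b + suc c ≡ n
  size = trans (ℕ.+-assoc a (suc b) (suc c)) (trans (ℕ.+-comm a (suc b + suc c))
    (cong (λ t → t + a) (cong suc (ℕ.+-suc b c))))
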